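{- Let $s, t$ be fixed integers with $2 \leq s \leq t$. Then there exists a constant $c = c(s,t) > 0$ such that for all positive integers $m, n$ with $m \leq n^{t^{1/(s-1)}/(s(s-1))}$, \[ z(m, n; s, t) \geq c\, m\, n^{1 - 1/s}. \] That is, $z(m,n;s,t) = \Omega(m n^{1-1/s})$ in this range, with the implied constant depending only on $s$ and $t$.
   Context: For positive integers $m, n, s, t$, the Zarankiewicz number $z(m, n; s, t)$ is the maximum number of edges in a bipartite graph $G = (U, V; E)$ with $|U| = m$ and $|V| = n$ that contains no copy of $K_{s,t}$ in which the part of size $s$ lies in $U$ and the part of size $t$ lies in $V$. Equivalently, it is the largest number of $1$'s in an $m \times n$ matrix with entries in $\{0,1\}$ containing no $s \times t$ submatrix consisting entirely of $1$'s. -}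

module Defs where

open import Data.Nat using (ℕ; zero; suc; _+_; _*_; _^_; _≤_; _<_; _∸_)
open import Data.Bool using (Bool; true; false; if_then_else_)
open import Data.Fin using (Fin)
open import Data.Product using (Σ; _×_)
open import Data.Fin.Subset using (Subset; _∈_; ∣_∣)
open import Data.List using (List; map; allFin)
open import Data.Nat.ListAction using (sum)
open import Relation.Binary.PropositionalEquality using (_≡_)
open import Relation.Nullary using (¬_)

Matrix : ℕ → ℕ → Set
Matrix m n = Fin m → Fin n → Bool

ones : ∀ {m n} → Matrix m n → ℕ
ones {m} {n} M =
  sum (map (λ i → sum (map (λ j → if M i j then 1 else 0) (allFin n))) (allFin m))

KstFree : ℕ → ℕ → ∀ {m n} → Matrix m n → Set
KstFree s t {m} {n} M =
  (S : Subset m) (T : Subset n) → ∣ S ∣ ≡ s → ∣ T ∣ ≡ t →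
  ¬ (∀ i j → i ∈ S → j ∈ T → M i j ≡ true)

-- The real condition  m ≤ n ^ α  with  α = t^{1/(s-1)} / (s(s-1)),
-- expressed without reals: for every rational p/q > α (q ≥ 1),  m^q ≤ n^p.
-- p/q > α  ⇔  (p·s·(s-1))^(s-1) > t·q^(s-1).
BelowExp : ℕ → ℕ → ℕ → ℕ → Set
BelowExp s t m n =
  (p q : ℕ) → 1 ≤ q → t * q ^ (s ∸ 1) < (p * (s * (s ∸ 1))) ^ (s ∸ 1) →
  m ^ q ≤ n ^ p

-- Write s = k + 1 and let d be maximal with d^k < t. Let F be a prime field with p elements, p^s of
-- the order of n, and K/F a field extension of degree D. Columns are pairs (χ, y) of a polynomial χ
-- over F of degree at most k, suitably normalised, and y ∈ F; rows are representatives θ of the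
-- Frobenius orbits in K; the entry is 1 when N(χ(θ)) = y, where N is the norm from K to F. Here
-- N(χ(θ)) is a product of D linear forms in χ, namely the values of χ at the conjugates of θ, and
-- any k + 1 of these forms belonging to distinct rows span all linear forms, by Lagrange
-- interpolation. This yields a Bézout bound: s rows have at most D^k common values N(χ(θ)).
-- There are about p^D / D rows, so any D with (d + 1)/k ≤ D ≤ d suffices. For k ≥ 2 this interval
-- contains a power of 2, so K can be a tower of quadratic extensions; for k = 1 the rows
-- are the polynomials of degree less than t over F and the columns the points of F².
-- The prime p comes from a weak form of Bertrand's postulate.
module Submission where

open import Defs
open import Level using (0ℓ)
open import Algebra.Bundles using (CommutativeRing)
open import Algebra.Structures using (IsCommutativeRing)
open import Data.Nat.Base as ℕ using (ℕ; zero; suc; z≤n; s≤s)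
import Data.Nat.Properties as ℕ
import Data.Nat.Solver as ℕSolver
open import Data.Nat.Divisibility using (_∣_; divides; m%n≡0⇒n∣m; ∣⇒≤)
open import Data.Nat.DivMod using (_mod_; _%_; _/_; m%n<n; m<n⇒m%n≡m; m/n*n≡m; %-distribˡ-+; %-distribˡ-*; m%n%n≡m%n; n%n≡0; m≡m%n+[m/n]*n)
open import Data.Nat.Induction using (<-wellFounded)
open import Data.Nat.Primality
open import Data.Fin.Base using (Fin; zero; suc; toℕ; fromℕ; inject₁; inject≤; cast; combine; remQuot; punchIn; punchOut; finToFun; funToFin)
import Data.Fin.Properties as Fin
open import Data.Product using (Σ; ∃; _×_; _,_; proj₁; proj₂)
open import Data.Product.Properties using (,-injectiveˡ)
open import Data.Sum using (_⊎_; inj₁; inj₂)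
open import Data.Vec.Functional using (updateAt)
open import Function.Base using (_∘_; id)
open import Induction.WellFounded using (Acc; acc)
open import Relation.Nullary using (¬_; yes; no; contradiction; Dec; does)
open import Relation.Nullary.Decidable using (from-yes; dec-true; map′; ¬?; _×-dec_)
open import Relation.Binary.PropositionalEquality hiding ([_])

-- The two ends of the interval for D answer two requirements. As t ≤ (d+1)^k, the hypothesis bounds
-- m^(sk) by about n^(d+1), hence m^k by a constant times p^(d+1); having p^D / D rows for all m, up
-- to a constant factor, asks for Dk ≥ d+1. Freeness asks for D^k < t, that is D ≤ d. A row is the
-- graph of a function of χ, so it carries p^k ones, which is of order n^(1-1/s). Bézout's bound is
-- pure linear algebra: on r points any function is a combination of products of r linear forms, and
-- where the norms agree all these products lie in the span of D^k monomials. Comparing numbers of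
-- functions over the finite field K then gives r ≤ D^k. A degree that is a power of 2 keeps the
-- field theory elementary: each step of the tower needs one nonsquare, found by counting. Primes
-- matter only up to a constant factor, since n^(1/s) is rounded to a power of 4 anyway. Fractional
-- exponents never occur: each estimate is raised to a power and roots are extracted by
-- monotonicity.

-- Primes within a constant factor of every power of 4

module Chebyshev where
  open import Data.Nat
  open import Data.Nat.Properties
  open import Data.Nat.Divisibility
  open import Data.Nat.Combinatorics using (_C_; nCk≡n!/k![n-k]!; k![n∸k]!∣n!; nCk+nC[k+1]≡[n+1]C[k+1])
  open import Data.Nat.Primality.Factorisation using (factorise)
  open import Data.Nat.ListAction using (product)
  open import Data.List.Base using (List; []; _∷_)
  open import Data.List.Relation.Unary.All using (All; []; _∷_)
  open ℕSolver.+-*-Solver using (solve; _:*_; _:+_; _:=_; con)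

  -- Leibniz's harmonic triangle: the reciprocals 1/((k+1) C(k+j+1, k+1)) are
  -- differences of their neighbours, starting from 1/(j+1).
  leibniz : ∀ X k j → (∀ i → 1 ≤ i → i ≤ suc (k + j) → i ∣ X) → suc (k + j) ! ∣ X * (k ! * j !)
  leibniz X zero j X-div with X-div (suc j) (s≤s z≤n) ≤-refl
  ... | divides c X≡ = divides c (begin
    X * (1 * j !)          ≡⟨ cong₂ _*_ X≡ (*-identityˡ (j !)) ⟩
    c * suc j * j !        ≡⟨ *-assoc c (suc j) (j !) ⟩
    c * (suc j * j !)      ∎)
    where open ≡-Reasoning
  leibniz X (suc k) j X-div
    with leibniz X k j (λ i 1≤i i≤ → X-div i 1≤i (m≤n⇒m≤1+n i≤))
       | leibniz X k (suc j) (λ i 1≤i i≤ → X-div i 1≤i (subst (i ≤_) (cong suc (+-suc k j)) i≤))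
  ... | divides a eqa | divides b eqb = subst (F ∣_) (sym split) (∣m+n∣m⇒∣n {m = X * (k ! * suc j !)} (divides a both) (divides b eqb′))
    where
    open ≡-Reasoning
    F = suc (suc (k + j)) !
    eqb′ : X * (k ! * suc j !) ≡ b * F
    eqb′ = trans eqb (cong (λ z → b * (suc z) !) (+-suc k j))
    both : X * (k ! * suc j !) + X * k ! * j ! * suc k ≡ a * F
    both = begin
      X * (k ! * (suc j * j !)) + X * k ! * j ! * suc k
        ≡⟨ solve 5 (λ X K J k j → X :* (K :* ((con 1 :+ j) :* J)) :+ X :* K :* J :* (con 1 :+ k)
                                  := (con 2 :+ (k :+ j)) :* (X :* (K :* J))) refl X (k !) (j !) k j ⟩
      suc (suc (k + j)) * (X * (k ! * j !))
        ≡⟨ cong (suc (suc (k + j)) *_) eqa ⟩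
      suc (suc (k + j)) * (a * suc (k + j) !)
        ≡⟨ solve 3 (λ m a F → m :* (a :* F) := a :* (m :* F)) refl (suc (suc (k + j))) a (suc (k + j) !) ⟩
      a * F ∎
    split : X * (suc k ! * j !) ≡ X * k ! * j ! * suc k
    split = solve 4 (λ X K J k → X :* (((con 1 :+ k) :* K) :* J) := X :* K :* J :* (con 1 :+ k)) refl X (k !) (j !) k

  -- Passing from `i` to `i + 1` multiplies the left side by `2(i + 1)` and the right side by
  -- `k + i + 1`, which is at least as large because `i < k`.
  2^i*k!*i!≤[k+i]! : ∀ k i → i ≤ k → 2 ^ i * (k ! * i !) ≤ (k + i) !
  2^i*k!*i!≤[k+i]! k zero _ = ≤-reflexive (begin
    1 * (k ! * 1)  ≡⟨ *-identityˡ _ ⟩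
    k ! * 1        ≡⟨ *-identityʳ _ ⟩
    k !            ≡⟨ cong _! (+-identityʳ k) ⟨
    (k + 0) !      ∎)
    where open ≡-Reasoning
  2^i*k!*i!≤[k+i]! k (suc i) i<k = begin
    2 * 2 ^ i * (k ! * (suc i * i !))
      ≡⟨ solve 4 (λ p K i I → con 2 :* p :* (K :* ((con 1 :+ i) :* I))
                    := (con 1 :+ i :+ (con 1 :+ i)) :* (p :* (K :* I))) refl (2 ^ i) (k !) i (i !) ⟩
    (suc i + suc i) * (2 ^ i * (k ! * i !))
      ≤⟨ *-mono-≤ (s≤s (≤-trans (≤-reflexive (+-suc i i)) (+-monoˡ-≤ i i<k))) (2^i*k!*i!≤[k+i]! k i (<⇒≤ i<k)) ⟩
    suc (k + i) * (k + i) !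
      ≡⟨ cong _! (+-suc k i) ⟨
    (k + suc i) ! ∎
    where open ≤-Reasoning

  -- By `leibniz`, `X` is a multiple of (2K)! / (K! (K-1)!), which is K times the central binomial
  -- coefficient and so at least 2^K.
  2^K≤commonMultiple : ∀ X K → 1 ≤ X → (∀ i → 1 ≤ i → i ≤ K + K → i ∣ X) → 2 ^ K ≤ X
  2^K≤commonMultiple X zero 1≤X _ = 1≤X
  2^K≤commonMultiple X (suc k) 1≤X X-div = *-cancelʳ-≤ (2 ^ suc k) X (suc k ! * k !) (begin
    2 ^ suc k * (suc k ! * k !)      ≤⟨ *-monoʳ-≤ (2 ^ suc k) (*-monoʳ-≤ (suc k !) (m≤n*m (k !) (suc k))) ⟩
    2 ^ suc k * (suc k ! * suc k !)  ≤⟨ 2^i*k!*i!≤[k+i]! (suc k) (suc k) ≤-refl ⟩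
    (suc k + suc k) !                ≡⟨ cong _! (cong suc (+-suc k k)) ⟩
    suc (suc k + k) !                ≤⟨ ∣⇒≤ {{m*n≢0 X _ {{>-nonZero 1≤X}} {{suc k !* k !≢0}}}}
                                            (leibniz X (suc k) k λ i 1≤i i≤ → X-div i 1≤i (subst (i ≤_) (cong suc (sym (+-suc k k))) i≤)) ⟩
    X * (suc k ! * k !)              ∎)
    where
    open ≤-Reasoning
    instance _ = suc k !* k !≢0

  -- over the half-open interval (x , x + y]
  primeProduct : ℕ → ℕ → ℕ
  primeProduct x zero = 1
  primeProduct x (suc y) with prime? (suc (x + y))
  ... | yes _ = suc (x + y) * primeProduct x y
  ... | no  _ = primeProduct x y

  primeProduct-+ : ∀ x y → primeProduct 0 (x + y) ≡ primeProduct 0 x * primeProduct x y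
  primeProduct-+ x zero = trans (cong (primeProduct 0) (+-identityʳ x)) (sym (*-identityʳ _))
  primeProduct-+ x (suc y) rewrite +-suc x y with prime? (suc (x + y))
  ... | no _ = primeProduct-+ x y
  ... | yes _ = begin
    suc (x + y) * primeProduct 0 (x + y)
      ≡⟨ cong (suc (x + y) *_) (primeProduct-+ x y) ⟩
    suc (x + y) * (primeProduct 0 x * primeProduct x y)
      ≡⟨ solve 3 (λ a b c → a :* (b :* c) := b :* (a :* c)) refl (suc (x + y)) (primeProduct 0 x) (primeProduct x y) ⟩
    primeProduct 0 x * (suc (x + y) * primeProduct x y) ∎
    where open ≡-Reasoning

  1≤primeProduct : ∀ x y → 1 ≤ primeProduct x y
  1≤primeProduct x zero = ≤-refl
  1≤primeProduct x (suc y) with prime? (suc (x + y))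
  ... | yes _ = *-mono-≤ {1} {suc (x + y)} (s≤s z≤n) (1≤primeProduct x y)
  ... | no  _ = 1≤primeProduct x y

  prime∣primeProduct : ∀ {p} x y → Prime p → x < p → p ≤ x + y → p ∣ primeProduct x y
  prime∣primeProduct x zero pr x<p p≤ = contradiction (≤-trans p≤ (≤-reflexive (+-identityʳ x))) (<⇒≱ x<p)
  prime∣primeProduct {p} x (suc y) pr x<p p≤ with prime? (suc (x + y)) | p ≟ suc (x + y)
  ... | yes _  | yes refl = m∣m*n _
  ... | no ¬pr | yes refl = contradiction pr ¬pr
  ... | yes _  | no p≢    = ∣n⇒∣m*n (suc (x + y)) (prime∣primeProduct x y pr x<p (s≤s⁻¹ (≤∧≢⇒< (subst (p ≤_) (+-suc x y) p≤) p≢)))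
  ... | no _   | no p≢    = prime∣primeProduct x y pr x<p (s≤s⁻¹ (≤∧≢⇒< (subst (p ≤_) (+-suc x y) p≤) p≢))

  1<prime : ∀ {p} → Prime p → 1 < p
  1<prime {p} pr = nonTrivial⇒n>1 p {{prime⇒nonTrivial pr}}

  prime∤primeProduct : ∀ {p} x y → Prime p → x + y < p → ¬ (p ∣ primeProduct x y)
  prime∤primeProduct {p} x zero pr _ p∣1 = contradiction (∣⇒≤ p∣1) (<⇒≱ (1<prime pr))
  prime∤primeProduct {p} x (suc y) pr x+y<p with prime? (suc (x + y))
  ... | no _  = prime∤primeProduct x y pr (<-trans (≤-reflexive (sym (+-suc x y))) x+y<p)
  ... | yes _ = λ p∣ → case (euclidsLemma (suc (x + y)) (primeProduct x y) pr p∣)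
    where
    case : p ∣ suc (x + y) ⊎ p ∣ primeProduct x y → _
    case (inj₁ d) = contradiction (∣⇒≤ d) (<⇒≱ (subst (_< p) (+-suc x y) x+y<p))
    case (inj₂ d) = prime∤primeProduct x y pr (<-trans (≤-reflexive (sym (+-suc x y))) x+y<p) d

  -- The newest prime exceeds all earlier ones, so it cannot divide their product and must divide
  -- the cofactor.
  primeProduct∣ : ∀ {B} x y → (∀ {p} → Prime p → x < p → p ≤ x + y → p ∣ B) → primeProduct x y ∣ B
  primeProduct∣ x zero _ = 1∣ _
  primeProduct∣ {B} x (suc y) B-div
    with primeProduct∣ x y (λ pr x<p p≤ → B-div pr x<p (≤-trans p≤ (+-monoʳ-≤ x (n≤1+n y)))) | prime? (suc (x + y))
  ... | ih | no _ = ih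
  ... | divides c B≡ | yes pr with euclidsLemma c (primeProduct x y) pr (subst (_ ∣_) B≡ (B-div pr (s≤s (m≤m+n x y)) (≤-reflexive (sym (+-suc x y)))))
  ...   | inj₂ d = contradiction d (prime∤primeProduct x y pr ≤-refl)
  ...   | inj₁ (divides d c≡) = divides d (trans B≡ (trans (cong (_* primeProduct x y) c≡) (*-assoc d (suc (x + y)) (primeProduct x y))))

  nCk≤2^n : ∀ n k → n C k ≤ 2 ^ n
  nCk≤2^n zero zero = ≤-refl
  nCk≤2^n zero (suc k) = z≤n
  nCk≤2^n (suc n) zero = m^n>0 2 (suc n)
  nCk≤2^n (suc n) (suc k) = begin
    suc n C suc k        ≡⟨ nCk+nC[k+1]≡[n+1]C[k+1] n k ⟨
    n C k + n C suc k    ≤⟨ +-mono-≤ (nCk≤2^n n k) (nCk≤2^n n (suc k)) ⟩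
    2 ^ n + 2 ^ n        ≡⟨ cong (2 ^ n +_) (+-identityʳ (2 ^ n)) ⟨
    2 ^ suc n            ∎
    where open ≤-Reasoning

  nCk*k!*[n∸k]!≡n! : ∀ {n k} → k ≤ n → (n C k) * (k ! * (n ∸ k) !) ≡ n !
  nCk*k!*[n∸k]!≡n! {n} {k} k≤n = trans (cong (_* (k ! * (n ∸ k) !)) (nCk≡n!/k![n-k]! k≤n)) (m/n*n≡m (k![n∸k]!∣n! k≤n))
    where instance _ = k !* (n ∸ k) !≢0

  prime∤! : ∀ {p} x → Prime p → x < p → ¬ (p ∣ x !)
  prime∤! zero pr x<p p∣1 = contradiction (∣⇒≤ p∣1) (<⇒≱ (1<prime pr))
  prime∤! (suc x) pr x<p p∣ with euclidsLemma (suc x) (x !) pr p∣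
  ... | inj₁ d = contradiction (∣⇒≤ d) (<⇒≱ x<p)
  ... | inj₂ d = prime∤! x pr (<-trans (n<1+n x) x<p) d

  n∣n! : ∀ n → 1 ≤ n → n ∣ n !
  n∣n! (suc n) _ = m∣m*n (n !)

  i∣n! : ∀ {i n} → 1 ≤ i → i ≤ n → i ∣ n !
  i∣n! {i} 1≤i i≤n = ∣-trans (n∣n! i 1≤i) (m≤n⇒m!∣n! i≤n)

  prime∣nCk : ∀ {p} k → Prime p → 1 ≤ k → k < p → p ∣ p C k
  prime∣nCk {p} k pr 1≤k k<p with euclidsLemma (p C k) (k ! * (p ∸ k) !) pr
    (subst (p ∣_) (sym (nCk*k!*[n∸k]!≡n! (<⇒≤ k<p))) (n∣n! p (<⇒≤ (1<prime pr))))
  ... | inj₁ d = d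
  ... | inj₂ d with euclidsLemma (k !) ((p ∸ k) !) pr d
  ...   | inj₁ e = contradiction e (prime∤! k pr k<p)
  ...   | inj₂ e = contradiction e (prime∤! (p ∸ k) pr (∸-monoʳ-< 1≤k (<⇒≤ k<p)))

  -- Primes in (x, 2x] divide (2x)! but not x! x!, so they all divide the central binomial
  -- coefficient.
  primeProduct[x,x]≤2^2x : ∀ x → primeProduct x x ≤ 2 ^ (x + x)
  primeProduct[x,x]≤2^2x x = ≤-trans (∣⇒≤ {{C≢0}} (primeProduct∣ x x p∣C)) (nCk≤2^n (x + x) x)
    where
    x!x! : ((x + x) C x) * (x ! * x !) ≡ (x + x) !
    x!x! = trans (cong (λ z → ((x + x) C x) * (x ! * z !)) (sym (m+n∸n≡m x x))) (nCk*k!*[n∸k]!≡n! (m≤m+n x x))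
    C≢0 : NonZero ((x + x) C x)
    C≢0 = m*n≢0⇒m≢0 ((x + x) C x) {{subst NonZero (sym x!x!) ((x + x) !≢0)}}
    p∣C : ∀ {p} → Prime p → x < p → p ≤ x + x → p ∣ (x + x) C x
    p∣C {p} pr x<p p≤ with euclidsLemma ((x + x) C x) (x ! * x !) pr (subst (p ∣_) (sym x!x!) (i∣n! (≤-trans (s≤s z≤n) x<p) p≤))
    ... | inj₁ d = d
    ... | inj₂ d with euclidsLemma (x !) (x !) pr d
    ...   | inj₁ e = contradiction e (prime∤! x pr x<p)
    ...   | inj₂ e = contradiction e (prime∤! x pr x<p)

  -- The range is doubled each time, and the interval (2^a, 2^(a+1)] contributes at most as much as
  -- the bound already reached, so the exponent doubles too.
  primorial≤ : ∀ a → primeProduct 0 (2 ^ a) ≤ 2 ^ (2 * 2 ^ a)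
  primorial≤ zero = s≤s z≤n
  primorial≤ (suc a) = begin
    primeProduct 0 (2 ^ suc a)                              ≡⟨ cong (λ z → primeProduct 0 (2 ^ a + z)) (+-identityʳ (2 ^ a)) ⟩
    primeProduct 0 (2 ^ a + 2 ^ a)                          ≡⟨ primeProduct-+ (2 ^ a) (2 ^ a) ⟩
    primeProduct 0 (2 ^ a) * primeProduct (2 ^ a) (2 ^ a)   ≤⟨ *-mono-≤ (primorial≤ a) (primeProduct[x,x]≤2^2x (2 ^ a)) ⟩
    2 ^ (2 * 2 ^ a) * 2 ^ (2 ^ a + 2 ^ a)                   ≡⟨ ^-distribˡ-+-* 2 (2 * 2 ^ a) (2 ^ a + 2 ^ a) ⟨
    2 ^ (2 * 2 ^ a + (2 ^ a + 2 ^ a))                       ≡⟨ cong (2 ^_) (solve 1 (λ w → con 2 :* w :+ (w :+ w) := con 2 :* (con 2 :* w)) refl (2 ^ a)) ⟩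
    2 ^ (2 * 2 ^ suc a)                                     ∎
    where open ≤-Reasoning

  n!≤m^n : ∀ n m → n ≤ m → n ! ≤ m ^ n
  n!≤m^n zero m _ = ≤-refl
  n!≤m^n (suc n) m n<m = *-mono-≤ n<m (n!≤m^n n m (<⇒≤ n<m))

  primeDivisor : ∀ n → 2 ≤ n → ∃ λ p → Prime p × p ∣ n
  primeDivisor n 2≤n with factorise n {{>-nonZero (<⇒≤ 2≤n)}}
  ... | record { factors = [] ; isFactorisation = n≡1 } = contradiction 2≤n (<⇒≱ (≤-reflexive (cong suc n≡1)))
  ... | record { factors = p ∷ ps ; isFactorisation = n≡ ; factorsPrime = pr ∷ _ } = p , pr , divides (product ps) (trans n≡ (*-comm p (product ps)))

  -- A number up to 2^e has at most `e` prime factors with multiplicity. If all are at most `R`,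
  -- each divides its own copy of `R !`.
  smooth⊎largePrime : ∀ R e i → 1 ≤ i → i ≤ 2 ^ e → i ∣ (R !) ^ e ⊎ ∃ λ p → Prime p × R < p × p ∣ i
  smooth⊎largePrime R zero i 1≤i i≤1 = inj₁ (subst (_∣ 1) (≤-antisym 1≤i i≤1) ∣-refl)
  smooth⊎largePrime R (suc e) i 1≤i i≤ with i ≟ 1
  ... | yes refl = inj₁ (1∣ _)
  ... | no i≢1 with primeDivisor i (≤∧≢⇒< 1≤i (λ eq → i≢1 (sym eq)))
  ...   | p , pr , p∣i@(divides c i≡) with p ≤? R
  ...     | no p≰R = inj₂ (p , pr , ≰⇒> p≰R , p∣i)
  ...     | yes p≤R with smooth⊎largePrime R e c 1≤c c≤
    where
    1≤c : 1 ≤ c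
    1≤c = n≢0⇒n>0 λ { refl → contradiction 1≤i (<⇒≱ (≤-reflexive (cong suc i≡))) }
    c≤ : c ≤ 2 ^ e
    c≤ = *-cancelʳ-≤ c (2 ^ e) 2 (begin
      c * 2      ≤⟨ *-monoʳ-≤ c (1<prime pr) ⟩
      c * p      ≡⟨ i≡ ⟨
      i          ≤⟨ i≤ ⟩
      2 * 2 ^ e  ≡⟨ *-comm 2 (2 ^ e) ⟩
      2 ^ e * 2  ∎)
      where open ≤-Reasoning
  ...       | inj₁ d = inj₁ (subst (_∣ (R !) ^ suc e) (trans (*-comm p c) (sym i≡)) (*-pres-∣ (i∣n! (<⇒≤ (1<prime pr)) p≤R) d))
  ...       | inj₂ (q , prq , R<q , q∣c) = inj₂ (q , prq , R<q , subst (q ∣_) (sym i≡) (∣m⇒∣m*n p q∣c))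

  -- The offset 10 is sharp: the inequality fails at h = 9. It makes the smooth part in
  -- `primeInWindow` small enough.
  8h²≤2^h : ∀ m → 8 * ((m + 10) * (m + 10)) ≤ 2 ^ (m + 10)
  8h²≤2^h zero = ≤ᵇ⇒≤ 800 1024 _
  8h²≤2^h (suc m) = begin
    8 * ((suc m + 10) * (suc m + 10))  ≤⟨ m≤m+n _ (8 * (79 + 18 * m + m * m)) ⟩
    8 * ((suc m + 10) * (suc m + 10)) + 8 * (79 + 18 * m + m * m)
      ≡⟨ solve 1 (λ m → con 8 :* ((con 1 :+ m :+ con 10) :* (con 1 :+ m :+ con 10)) :+ con 8 :* (con 79 :+ con 18 :* m :+ m :* m)
                    := con 2 :* (con 8 :* ((m :+ con 10) :* (m :+ con 10)))) refl m ⟩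
    2 * (8 * ((m + 10) * (m + 10)))    ≤⟨ *-monoʳ-≤ 2 (8h²≤2^h m) ⟩
    2 * 2 ^ (m + 10)                   ∎
    where open ≤-Reasoning

  -- Without a prime in (W, 16W], the number `X` would be a common multiple of 1, ..., 16W, hence at
  -- least 2^(8W); but its size is at most 2^(6W).
  primeInWindow : ∀ h a W R → W ≡ 2 ^ a → R ≡ 2 ^ h → R * R ≡ 16 * W → 8 * (h * h) ≤ R →
    ∃ λ p → Prime p × W < p × p ≤ 16 * W
  primeInWindow h a W R W≡ R≡ R*R≡16W 8h²≤R with anyUpTo? (λ p → prime? p ×-dec (W <? p)) (suc (16 * W))
  ... | yes (p , p< , pr , W<p) = p , pr , W<p , s≤s⁻¹ p<
  ... | no none = contradiction (≤-trans lower upper) (<⇒≱ (^-monoʳ-< 2 (s≤s (s≤s z≤n)) 6W<8W))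
    where
    X = primeProduct 0 W * (R !) ^ (2 * h)
    1≤W : 1 ≤ W
    1≤W = subst (1 ≤_) (sym W≡) (m^n>0 2 a)
    6W<8W : 2 * W + 4 * W < 8 * W
    6W<8W = begin-strict
      2 * W + 4 * W      ≡⟨ *-distribʳ-+ W 2 4 ⟨
      6 * W              <⟨ *-monoˡ-< W {{>-nonZero 1≤W}} (≤ᵇ⇒≤ 7 8 _) ⟩
      8 * W              ∎
      where open ≤-Reasoning
    i≤2^2h : ∀ {i} → i ≤ 8 * W + 8 * W → i ≤ 2 ^ (2 * h)
    i≤2^2h {i} i≤ = begin
      i                ≤⟨ i≤ ⟩
      8 * W + 8 * W    ≡⟨ *-distribʳ-+ W 8 8 ⟨
      16 * W           ≡⟨ R*R≡16W ⟨
      R * R            ≡⟨ cong₂ _*_ R≡ R≡ ⟩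
      2 ^ h * 2 ^ h    ≡⟨ ^-distribˡ-+-* 2 h h ⟨
      2 ^ (h + h)      ≡⟨ cong (λ z → 2 ^ (h + z)) (+-identityʳ h) ⟨
      2 ^ (2 * h)      ∎
      where open ≤-Reasoning
    X-div : ∀ i → 1 ≤ i → i ≤ 8 * W + 8 * W → i ∣ X
    X-div i 1≤i i≤ with smooth⊎largePrime R (2 * h) i 1≤i (i≤2^2h i≤)
    ... | inj₁ d = ∣n⇒∣m*n (primeProduct 0 W) d
    ... | inj₂ (p , pr , R<p , divides c i≡) =
      subst (_∣ X) (trans (*-comm p c) (sym i≡)) (*-pres-∣ p∣ (c∣power h R≡))
      where
      open ≤-Reasoning
      1≤c : 1 ≤ c
      1≤c = n≢0⇒n>0 λ { refl → contradiction 1≤i (<⇒≱ (≤-reflexive (cong suc i≡))) }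
      i≤16W : i ≤ 16 * W
      i≤16W = ≤-trans i≤ (≤-reflexive (sym (*-distribʳ-+ W 8 8)))
      p≤16W : p ≤ 16 * W
      p≤16W = begin
        p      ≤⟨ m≤n*m p c {{>-nonZero 1≤c}} ⟩
        c * p  ≡⟨ i≡ ⟨
        i      ≤⟨ i≤16W ⟩
        16 * W ∎
      -- Numbers up to R² = 16W have room for only one prime factor above `R`. The primorial takes
      -- care of that prime, and the cofactor divides `R !`.
      c<R : c < R
      c<R = ≰⇒> λ R≤c → <⇒≱ (begin-strict
        16 * W   ≡⟨ R*R≡16W ⟨
        R * R    <⟨ *-monoʳ-< R {{>-nonZero (subst (1 ≤_) (sym R≡) (m^n>0 2 h))}} R<p ⟩
        R * p    ≤⟨ *-monoˡ-≤ p R≤c ⟩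
        c * p    ≡⟨ i≡ ⟨
        i        ∎) i≤16W
      p∣ : p ∣ primeProduct 0 W
      p∣ = prime∣primeProduct 0 W pr (<⇒≤ (1<prime pr)) (≮⇒≥ λ W<p → none (p , s≤s p≤16W , pr , W<p))
      c∣power : ∀ h → R ≡ 2 ^ h → c ∣ (R !) ^ (2 * h)
      c∣power zero refl = contradiction (n<1⇒n≡0 c<R) (m<n⇒n≢0 1≤c)
      c∣power (suc h) _ = ∣-trans (i∣n! 1≤c (<⇒≤ c<R)) (m∣m*n _)
    lower : 2 ^ (8 * W) ≤ X
    lower = 2^K≤commonMultiple X (8 * W) (*-mono-≤ (1≤primeProduct 0 W) (m^n>0 (R !) {{R !≢0}} (2 * h))) X-div
    -- From R! ≤ R^R = 2^(hR), the power (R!)^(2h) contributes the exponent 2h²R, and 8h² ≤ R turns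
    -- it into at most R²/4 = 4W.
    exponent : h * R * (2 * h) ≤ 4 * W
    exponent = *-cancelˡ-≤ 4 (begin
      4 * (h * R * (2 * h))    ≡⟨ solve 2 (λ h R → con 4 :* (h :* R :* (con 2 :* h)) := con 8 :* (h :* h) :* R) refl h R ⟩
      8 * (h * h) * R          ≤⟨ *-monoˡ-≤ R 8h²≤R ⟩
      R * R                    ≡⟨ R*R≡16W ⟩
      16 * W                   ≡⟨ *-assoc 4 4 W ⟩
      4 * (4 * W)              ∎)
      where open ≤-Reasoning
    upper : X ≤ 2 ^ (2 * W + 4 * W)
    upper = begin
      primeProduct 0 W * (R !) ^ (2 * h)
        ≤⟨ *-mono-≤ (subst (λ W → primeProduct 0 W ≤ 2 ^ (2 * W)) (sym W≡) (primorial≤ a)) (^-monoˡ-≤ (2 * h) (n!≤m^n R R ≤-refl)) ⟩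
      2 ^ (2 * W) * (R ^ R) ^ (2 * h)
        ≡⟨ cong (λ z → 2 ^ (2 * W) * (z ^ R) ^ (2 * h)) R≡ ⟩
      2 ^ (2 * W) * ((2 ^ h) ^ R) ^ (2 * h)
        ≡⟨ cong (λ z → 2 ^ (2 * W) * z ^ (2 * h)) (^-*-assoc 2 h R) ⟩
      2 ^ (2 * W) * (2 ^ (h * R)) ^ (2 * h)
        ≡⟨ cong (2 ^ (2 * W) *_) (^-*-assoc 2 (h * R) (2 * h)) ⟩
      2 ^ (2 * W) * 2 ^ (h * R * (2 * h))
        ≤⟨ *-monoʳ-≤ (2 ^ (2 * W)) (^-monoʳ-≤ 2 exponent) ⟩
      2 ^ (2 * W) * 2 ^ (4 * W)
        ≡⟨ ^-distribˡ-+-* 2 (2 * W) (4 * W) ⟨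
      2 ^ (2 * W + 4 * W) ∎
      where open ≤-Reasoning

  -- With h = m + 10, the window is taken at R = 2^h and W = 4^(h-2), so that 16W = R² = 4^h is its
  -- upper end.
  primeNear4^ : ∀ m → ∃ λ p → Prime p × 3 ≤ p × p ≤ 4 ^ (m + 10) × 4 ^ (m + 10) ≤ 16 * p
  primeNear4^ m with primeInWindow (m + 10) (2 * (m + 8)) (4 ^ (m + 8)) (2 ^ (m + 10)) (^-*-assoc 2 2 (m + 8)) refl (trans R*R≡ (sym 16W≡)) (8h²≤2^h m)
    where
    open ≡-Reasoning
    16W≡ : 16 * 4 ^ (m + 8) ≡ 4 ^ (m + 10)
    16W≡ = begin
      16 * 4 ^ (m + 8)   ≡⟨ ^-distribˡ-+-* 4 2 (m + 8) ⟨
      4 ^ (2 + (m + 8))  ≡⟨ cong (4 ^_) (solve 1 (λ m → con 2 :+ (m :+ con 8) := m :+ con 10) refl m) ⟩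
      4 ^ (m + 10)       ∎
    R*R≡ : 2 ^ (m + 10) * 2 ^ (m + 10) ≡ 4 ^ (m + 10)
    R*R≡ = begin
      2 ^ (m + 10) * 2 ^ (m + 10)  ≡⟨ ^-distribˡ-+-* 2 (m + 10) (m + 10) ⟨
      2 ^ (m + 10 + (m + 10))      ≡⟨ cong (λ z → 2 ^ (m + 10 + z)) (+-identityʳ (m + 10)) ⟨
      2 ^ (2 * (m + 10))           ≡⟨ ^-*-assoc 2 2 (m + 10) ⟨
      4 ^ (m + 10)                 ∎
  ... | p , pr , W<p , p≤ = p , pr , 3≤p , subst (p ≤_) 16W≡ p≤ , ≤-trans (≤-reflexive (sym 16W≡)) (*-monoʳ-≤ 16 (<⇒≤ W<p))
    where
    16W≡ : 16 * 4 ^ (m + 8) ≡ 4 ^ (m + 10)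
    16W≡ = trans (sym (^-distribˡ-+-* 4 2 (m + 8))) (cong (4 ^_) (solve 1 (λ m → con 2 :+ (m :+ con 8) := m :+ con 10) refl m))
    3≤p : 3 ≤ p
    3≤p = ≤-trans (≤-trans (≤ᵇ⇒≤ 3 4 _) (^-monoʳ-≤ 4 {1} {m + 8} (≤-trans (≤ᵇ⇒≤ 1 8 _) (m≤n+m 8 m)))) (<⇒≤ W<p)

  NearPowersOf4 : ℕ → Set
  NearPowersOf4 c = ∀ h → 1 ≤ h → ∃ λ p → Prime p × 3 ≤ p × p ≤ 4 ^ h × 4 ^ h ≤ c * p

  prime[3] : Prime 3
  prime[3] = from-yes (prime? 3)

  -- Below the range of the window estimate the prime 3 serves, at the price of a larger constant
  -- `c`.
  nearPowersOf4 : ∀ c → (∀ h → h ≤ 10 → 4 ^ h ≤ c) → 16 ≤ c → NearPowersOf4 c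
  nearPowersOf4 c 4^h≤c 16≤c h 1≤h with h ≤? 10
  ... | yes h≤10 = 3 , prime[3] , ≤-refl , ≤-trans (n≤1+n 3) (^-monoʳ-≤ 4 1≤h)
                 , ≤-trans (4^h≤c h h≤10) (m≤m*n c 3)
  ... | no h≰10 = widen (m∸n+n≡m (<⇒≤ (≰⇒> h≰10))) (primeNear4^ (h ∸ 10))
    where
    widen : ∀ {h′} → h′ ≡ h → (∃ λ p → Prime p × 3 ≤ p × p ≤ 4 ^ h′ × 4 ^ h′ ≤ 16 * p) →
      ∃ λ p → Prime p × 3 ≤ p × p ≤ 4 ^ h × 4 ^ h ≤ c * p
    widen refl (p , pr , 3≤p , p≤ , ≤16p) = p , pr , 3≤p , p≤ , ≤-trans ≤16p (*-monoˡ-≤ p 16≤c)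

  abstract
    oddPrimesNearPowersOf4 : ∃ λ c → 1 ≤ c × NearPowersOf4 c
    oddPrimesNearPowersOf4 = build 10 refl
      where
      -- the cutoff stays a variable so that 4 ^ k + 16 is never evaluated
      build : ∀ k → k ≡ 10 → ∃ λ c → 1 ≤ c × NearPowersOf4 c
      build k k≡10 = 4 ^ k + 16 , ≤-trans (≤ᵇ⇒≤ 1 16 _) 16≤c
        , nearPowersOf4 (4 ^ k + 16) (λ h h≤10 → ≤-trans (^-monoʳ-≤ 4 (subst (h ≤_) (sym k≡10) h≤10)) (m≤m+n (4 ^ k) 16)) 16≤c
        where
        16≤c : 16 ≤ 4 ^ k + 16
        16≤c = m≤n+m 16 (4 ^ k)

-- Fields, polynomials and Lagrange interpolation

record Field : Set₁ where
  infixl 6 _+_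
  infixl 7 _*_
  field
    Carrier : Set
    _+_ _*_ : Carrier → Carrier → Carrier
    -_ : Carrier → Carrier
    0# 1# : Carrier
    isCommutativeRing : IsCommutativeRing _≡_ _+_ _*_ -_ 0# 1#
    1≢0 : 1# ≢ 0#
    inverse : ∀ x → x ≢ 0# → ∃ λ y → x * y ≡ 1#

  commutativeRing : CommutativeRing 0ℓ 0ℓ
  commutativeRing = record { isCommutativeRing = isCommutativeRing }

module FieldProperties (F : Field) where
  open Field F public using (1≢0; inverse)
  open CommutativeRing (Field.commutativeRing F) public
    hiding (refl; sym; trans; reflexive; _≈_; zero; isEquivalence; setoid; isCommutativeRing)
  open import Algebra.Properties.Semiring.Sum semiring public
    using (sum; ∑-distrib-+; *-distribˡ-sum; *-distribʳ-sum; sum-cong-≗; sum-replicate-zero; ∑-comm)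
  open import Algebra.Properties.CommutativeSemiring.Exp commutativeSemiring public
    using (_^_; ^-homo-*; ^-assocʳ; ^-distrib-*)
  open import Algebra.Properties.Ring ring public using (-‿distribˡ-*; -‿distribʳ-*; -‿involutive)
  open import Algebra.Properties.Semiring.Mult semiring public
    using (×-assoc-*; ×-assocˡ) renaming (_×_ to _⋆_)
  open import Algebra.Solver.Ring.NaturalCoefficients.Default commutativeSemiring
    using (solve; _:*_; _:+_; _:=_; con)
  open ≡-Reasoning

  x+[y-x]≡y : ∀ x y → x + (y - x) ≡ y
  x+[y-x]≡y x y = begin
    x + (y + - x)  ≡⟨ +-comm x _ ⟩
    y + - x + x    ≡⟨ +-assoc y (- x) x ⟩
    y + (- x + x)  ≡⟨ cong (y +_) (-‿inverseˡ x) ⟩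
    y + 0#         ≡⟨ +-identityʳ y ⟩
    y              ∎

  y-x≢0 : ∀ {x y} → x ≢ y → y - x ≢ 0#
  y-x≢0 {x} {y} x≢y y-x≡0 = x≢y (begin
    x            ≡⟨ +-identityʳ x ⟨
    x + 0#       ≡⟨ cong (x +_) y-x≡0 ⟨
    x + (y - x)  ≡⟨ x+[y-x]≡y x y ⟩
    y            ∎)

  *-cancelˡ-nonZero : ∀ x {y z} → x ≢ 0# → x * y ≡ x * z → y ≡ z
  *-cancelˡ-nonZero x {y} {z} x≢0 xy≡xz with inverse x x≢0
  ... | x⁻¹ , xx⁻¹≡1 = begin
    y                ≡⟨ expand y ⟩
    x⁻¹ * (x * y)    ≡⟨ cong (x⁻¹ *_) xy≡xz ⟩
    x⁻¹ * (x * z)    ≡⟨ expand z ⟨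
    z                ∎
    where
    expand : ∀ w → w ≡ x⁻¹ * (x * w)
    expand w = begin
      w              ≡⟨ *-identityˡ w ⟨
      1# * w         ≡⟨ cong (_* w) xx⁻¹≡1 ⟨
      x * x⁻¹ * w    ≡⟨ solve 3 (λ x i w → x :* i :* w := i :* (x :* w)) refl x x⁻¹ w ⟩
      x⁻¹ * (x * w)  ∎

  *-nonZero : ∀ {x y} → x ≢ 0# → y ≢ 0# → x * y ≢ 0#
  *-nonZero {x} x≢0 y≢0 xy≡0 = y≢0 (*-cancelˡ-nonZero x x≢0 (trans xy≡0 (sym (zeroʳ x))))

  1^n≡1 : ∀ n → 1# ^ n ≡ 1#
  1^n≡1 zero    = refl
  1^n≡1 (suc n) = trans (*-identityˡ _) (1^n≡1 n)

  ∏< : ℕ → (ℕ → Carrier) → Carrier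
  ∏< zero    a = 1#
  ∏< (suc n) a = a n * ∏< n a

  infix 8 _·_
  _·_ : ∀ {n} → (Fin n → Carrier) → (Fin n → Carrier) → Carrier
  _·_ a b = sum (λ i → a i * b i)

  -- the coefficients c are listed from the constant term up
  eval : ∀ {n} → (Fin n → Carrier) → Carrier → Carrier
  eval {zero}  c x = 0#
  eval {suc n} c x = c zero + x * eval (c ∘ suc) x

  -- Synthetic division by T - r: the coefficients of the quotient are the Horner tails of `c` at
  -- `r`.
  quotient : ∀ {n} → Carrier → (Fin (suc n) → Carrier) → Fin n → Carrier
  quotient r c zero    = eval (c ∘ suc) r
  quotient r c (suc i) = quotient r (c ∘ suc) i

  -- The remainder theorem. Writing the point as `r + d` removes subtraction, so that the semiring
  -- solver applies.
  eval-quotient : ∀ {n} r d (c : Fin (suc n) → Carrier) →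
    eval c (r + d) ≡ eval c r + d * eval (quotient r c) (r + d)
  eval-quotient {zero} r d c =
    solve 3 (λ r d c → c :+ (r :+ d) :* con 0 := (c :+ r :* con 0) :+ d :* con 0) refl r d (c zero)
  eval-quotient {suc n} r d c = begin
    c zero + (r + d) * eval (c ∘ suc) (r + d)
      ≡⟨ cong (λ z → c zero + (r + d) * z) (eval-quotient r d (c ∘ suc)) ⟩
    c zero + (r + d) * (eval (c ∘ suc) r + d * eval (quotient r (c ∘ suc)) (r + d))
      ≡⟨ solve 5 (λ r d c R q → c :+ (r :+ d) :* (R :+ d :* q) := (c :+ r :* R) :+ d :* (R :+ (r :+ d) :* q))
           refl r d (c zero) (eval (c ∘ suc) r) (eval (quotient r (c ∘ suc)) (r + d)) ⟩
    (c zero + r * eval (c ∘ suc) r) + d * (eval (c ∘ suc) r + (r + d) * eval (quotient r (c ∘ suc)) (r + d)) ∎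

  -- A polynomial is recovered from its value at `r` and its quotient q by c_0 = c(r) - r q_0 and
  -- c_(i+1) = q_i - r q_(i+1). A linear functional of `c` is therefore one of these data, and c(r)
  -- enters only through c_0.
  dot-quotient : ∀ {n} r (β : Fin (suc n) → Carrier) → ∃ λ (β′ : Fin n → Carrier) → ∀ c →
    β · c ≡ β zero * eval c r + β′ · quotient r c
  dot-quotient {zero} r β = (λ ()) , λ c →
    solve 3 (λ r b c → b :* c :+ con 0 := b :* (c :+ r :* con 0) :+ con 0) refl r (β zero) (c zero)
  dot-quotient {suc n} r β with dot-quotient r (β ∘ suc)
  ... | β″ , spec = β′ , λ c → begin
    β zero * c zero + (β ∘ suc) · (c ∘ suc)
      ≡⟨ cong (β zero * c zero +_) (spec (c ∘ suc)) ⟩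
    β zero * c zero + (β (suc zero) * eval (c ∘ suc) r + β″ · quotient r (c ∘ suc))
      ≡⟨ cong (λ z → β zero * c zero + (z * eval (c ∘ suc) r + β″ · quotient r (c ∘ suc))) (x+[y-x]≡y (r * β zero) (β (suc zero))) ⟨
    β zero * c zero + ((r * β zero + β′ zero) * eval (c ∘ suc) r + β″ · quotient r (c ∘ suc))
      ≡⟨ solve 6 (λ r b c b′ R q → b :* c :+ ((r :* b :+ b′) :* R :+ q) := b :* (c :+ r :* R) :+ (b′ :* R :+ q))
           refl r (β zero) (c zero) (β′ zero) (eval (c ∘ suc) r) (β″ · quotient r (c ∘ suc)) ⟩
    β zero * (c zero + r * eval (c ∘ suc) r) + (β′ zero * eval (c ∘ suc) r + β″ · quotient r (c ∘ suc)) ∎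
    where
    β′ : Fin (suc n) → Carrier
    β′ zero    = β (suc zero) - r * β zero
    β′ (suc i) = β″ i

  Distinct : ∀ {n} → (Fin n → Carrier) → Set
  Distinct ξ = ∀ {i j} → ξ i ≡ ξ j → i ≡ j

  -- Lagrange interpolation in dual form: evaluations at distinct nodes span all linear functionals
  -- on coefficient vectors. After splitting off the node r, the quotient at another node ξ is the
  -- divided difference (c(ξ) - c(r)) / (ξ - r), which is again made of evaluations of c.
  interpolation : ∀ {n} (ξ : Fin n → Carrier) → Distinct ξ → (β : Fin n → Carrier) →
    ∃ λ (α : Fin n → Carrier) → ∀ (c : Fin n → Carrier) → β · c ≡ α · (λ i → eval c (ξ i))
  interpolation {zero} ξ ξ-distinct β = β , λ c → refl
  interpolation {suc n} ξ ξ-distinct β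
    with dot-quotient (ξ zero) β
  ... | β′ , β-spec with interpolation (ξ ∘ suc) (Fin.suc-injective ∘ ξ-distinct) β′
  ...   | α′ , α′-spec = α , spec
    where
    r = ξ zero
    d : Fin n → Carrier
    d i = ξ (suc i) - r
    d⁻¹ : ∀ i → ∃ λ y → d i * y ≡ 1#
    d⁻¹ i = inverse (d i) (y-x≢0 λ eq → contradiction (ξ-distinct eq) λ ())
    γ : Fin n → Carrier
    γ i = α′ i * proj₁ (d⁻¹ i)
    α : Fin (suc n) → Carrier
    -- Every divided difference subtracts a multiple `γ i` of c(r); these corrections collect at the
    -- first node.
    α zero    = β zero - sum γ
    α (suc i) = γ i
    at-node : ∀ (c : Fin (suc n) → Carrier) i → γ i * eval c r + α′ i * eval (quotient r c) (ξ (suc i)) ≡ γ i * eval c (ξ (suc i))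
    at-node c i = begin
      γ i * R + α′ i * q
        ≡⟨ cong (λ z → γ i * R + z * q) (*-identityʳ (α′ i)) ⟨
      γ i * R + α′ i * 1# * q
        ≡⟨ cong (λ z → γ i * R + α′ i * z * q) (proj₂ (d⁻¹ i)) ⟨
      γ i * R + α′ i * (d i * proj₁ (d⁻¹ i)) * q
        ≡⟨ solve 5 (λ a e d R q → a :* e :* R :+ a :* (d :* e) :* q := a :* e :* (R :+ d :* q))
             refl (α′ i) (proj₁ (d⁻¹ i)) (d i) R q ⟩
      γ i * (R + d i * q)
        ≡⟨ cong (λ z → γ i * (R + d i * eval (quotient r c) z)) (x+[y-x]≡y r (ξ (suc i))) ⟨
      γ i * (R + d i * eval (quotient r c) (r + d i))
        ≡⟨ cong (γ i *_) (eval-quotient r (d i) c) ⟨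
      γ i * eval c (r + d i)
        ≡⟨ cong (λ z → γ i * eval c z) (x+[y-x]≡y r (ξ (suc i))) ⟩
      γ i * eval c (ξ (suc i)) ∎
      where
      R = eval c r
      q = eval (quotient r c) (ξ (suc i))
    spec : ∀ (c : Fin (suc n) → Carrier) → β · c ≡ α · (λ i → eval c (ξ i))
    spec c = begin
      β · c
        ≡⟨ β-spec c ⟩
      β zero * R + β′ · quotient r c
        ≡⟨ cong (β zero * R +_) (α′-spec (quotient r c)) ⟩
      β zero * R + sum (λ i → α′ i * q i)
        ≡⟨ cong (λ z → z * R + sum (λ i → α′ i * q i)) (trans (+-comm _ _) (x+[y-x]≡y (sum γ) (β zero))) ⟨
      (α zero + sum γ) * R + sum (λ i → α′ i * q i)
        ≡⟨ cong (_+ sum (λ i → α′ i * q i)) (distribʳ R (α zero) (sum γ)) ⟩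
      α zero * R + sum γ * R + sum (λ i → α′ i * q i)
        ≡⟨ +-assoc _ _ _ ⟩
      α zero * R + (sum γ * R + sum (λ i → α′ i * q i))
        ≡⟨ cong (λ z → α zero * R + (z + sum (λ i → α′ i * q i))) (*-distribʳ-sum R γ) ⟩
      α zero * R + (sum (λ i → γ i * R) + sum (λ i → α′ i * q i))
        ≡⟨ cong (α zero * R +_) (∑-distrib-+ (λ i → γ i * R) (λ i → α′ i * q i)) ⟨
      α zero * R + sum (λ i → γ i * R + α′ i * q i)
        ≡⟨ cong (α zero * R +_) (sum-cong-≗ (at-node c)) ⟩
      α zero * R + sum (λ i → γ i * eval c (ξ (suc i))) ∎
      where
      R = eval c r
      q : Fin n → Carrier
      q i = eval (quotient r c) (ξ (suc i))

  sum-zero : ∀ {n} (f : Fin n → Carrier) → (∀ i → f i ≡ 0#) → sum f ≡ 0#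
  sum-zero {n} f f≡0 = trans (sum-cong-≗ f≡0) (sum-replicate-zero n)

  sum-single : ∀ {n} (f : Fin n → Carrier) i → (∀ j → j ≢ i → f j ≡ 0#) → sum f ≡ f i
  sum-single {suc n} f zero others = trans (cong (f zero +_) (sum-zero (f ∘ suc) λ j → others (suc j) λ ())) (+-identityʳ _)
  sum-single {suc n} f (suc i) others = trans (cong₂ _+_ (others zero λ ()) (sum-single (f ∘ suc) i λ j j≢i → others (suc j) (j≢i ∘ Fin.suc-injective))) (+-identityˡ _)

  δ : ∀ {n} → Fin n → Fin n → Carrier
  δ zero    zero    = 1#
  δ zero    (suc j) = 0#
  δ (suc i) zero    = 0#
  δ (suc i) (suc j) = δ i j

  δ-same : ∀ {n} (i : Fin n) → δ i i ≡ 1#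
  δ-same zero    = refl
  δ-same (suc i) = δ-same i

  δ-other : ∀ {n} (i j : Fin n) → j ≢ i → δ i j ≡ 0#
  δ-other zero    zero    j≢i = contradiction refl j≢i
  δ-other zero    (suc j) j≢i = refl
  δ-other (suc i) zero    j≢i = refl
  δ-other (suc i) (suc j) j≢i = δ-other i j (j≢i ∘ cong suc)

  δ-· : ∀ {n} (i : Fin n) (c : Fin n → Carrier) → δ i · c ≡ c i
  δ-· i c = begin
    δ i · c    ≡⟨ sum-single (λ j → δ i j * c j) i (λ j j≢i → trans (cong (_* c j) (δ-other i j j≢i)) (zeroˡ (c j))) ⟩
    δ i i * c i ≡⟨ cong (_* c i) (δ-same i) ⟩
    1# * c i    ≡⟨ *-identityˡ (c i) ⟩
    c i         ∎

  -- Each coordinate functional is a combination of evaluations at the roots.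
  manyRoots⇒zero : ∀ {n} (ξ : Fin n → Carrier) → Distinct ξ → (c : Fin n → Carrier) → (∀ i → eval c (ξ i) ≡ 0#) → ∀ i → c i ≡ 0#
  manyRoots⇒zero ξ ξ-distinct c roots i with interpolation ξ ξ-distinct (δ i)
  ... | α , spec = begin
    c i                           ≡⟨ δ-· i c ⟨
    δ i · c                       ≡⟨ spec c ⟩
    α · (λ j → eval c (ξ j))      ≡⟨ sum-zero _ (λ j → trans (cong (α j *_) (roots j)) (zeroʳ (α j))) ⟩
    0#                            ∎

-- Bézout's bound for products of linear forms

total : ∀ {n} → (Fin n → ℕ) → ℕ
total {zero}  e = 0
total {suc n} e = e zero ℕ.+ total (e ∘ suc)

total-updateAt-suc : ∀ {n} (e : Fin n → ℕ) i → total (updateAt e i suc) ≡ suc (total e)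
total-updateAt-suc e zero    = refl
total-updateAt-suc e (suc i) = trans (cong (e zero ℕ.+_) (total-updateAt-suc (e ∘ suc) i)) (ℕ.+-suc (e zero) _)

total-zero : ∀ n → total {n} (λ _ → 0) ≡ 0
total-zero zero    = refl
total-zero (suc n) = total-zero n

total-cong : ∀ {n} {e f : Fin n → ℕ} → e ≗ f → total e ≡ total f
total-cong {zero}  e≗f = refl
total-cong {suc n} e≗f = cong₂ ℕ._+_ (e≗f zero) (total-cong (e≗f ∘ suc))

funToFin-cong : ∀ {m n} {f g : Fin m → Fin n} → f ≗ g → funToFin f ≡ funToFin g
funToFin-cong {zero}  f≗g = refl
funToFin-cong {suc m} f≗g = cong₂ combine (f≗g zero) (funToFin-cong (f≗g ∘ suc))

finToFun-injective : ∀ {m n} (i j : Fin (n ℕ.^ m)) → finToFun {n} {m} i ≗ finToFun j → i ≡ j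
finToFun-injective {m} {n} i j eq = trans (sym (Fin.funToFin-finToFin {m} {n} i)) (trans (funToFin-cong eq) (Fin.funToFin-finToFin {m} {n} j))

module _ (F : Field) where
  open FieldProperties F

  -- A form of Bézout's bound: products of linear forms are spanned by the monomials
  -- Π_i Π_{l < e_i} L i l of the same degree, because each linear form is a combination of
  -- the L i (e_i). As Π_{l < D} L i l does not depend on i on the given points, the exponents e_i
  -- with i > 0 may be reduced modulo D, which leaves D ^ k monomials of a given degree.
  module Bézout
    {Q : ℕ} (index : Carrier → Fin Q) (element : Fin Q → Carrier)
    (element-index : ∀ x → element (index x) ≡ x) (index-element : ∀ i → index (element i) ≡ i)
    (k D r : ℕ) .{{_ : ℕ.NonZero D}}
    (L : Fin (suc k) → ℕ → Fin r → Carrier)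
    (L-periodic : ∀ i l x → L i (D ℕ.+ l) x ≡ L i l x)
    (ℓ : Fin r → Fin r → Fin r → Carrier)
    (ℓ-zero : ∀ {z w} → w ≢ z → ℓ z w w ≡ 0#)
    (ℓ-nonZero : ∀ z w → ℓ z w z ≢ 0#)
    (ℓ-spanned : ∀ (e : Fin (suc k) → ℕ) z w → ∃ λ (α : Fin (suc k) → Carrier) → ∀ x → ℓ z w x ≡ α · (λ i → L i (e i) x))
    where
    open import Algebra.Solver.Ring.NaturalCoefficients.Default commutativeSemiring
      using (solve; _:*_; _:=_; con)
    open ≡-Reasoning

    ∏ : ∀ {n} → (Fin n → Carrier) → Carrier
    ∏ {zero}  f = 1#
    ∏ {suc n} f = f zero * ∏ (f ∘ suc)

    ∏-cong : ∀ {n} {f g : Fin n → Carrier} → f ≗ g → ∏ f ≡ ∏ g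
    ∏-cong {zero}  f≗g = refl
    ∏-cong {suc n} f≗g = cong₂ _*_ (f≗g zero) (∏-cong (f≗g ∘ suc))

    ∏-zero : ∀ {n} (f : Fin n → Carrier) i → f i ≡ 0# → ∏ f ≡ 0#
    ∏-zero f zero    fi≡0 = trans (cong (_* ∏ (f ∘ suc)) fi≡0) (zeroˡ _)
    ∏-zero f (suc i) fi≡0 = trans (cong (f zero *_) (∏-zero (f ∘ suc) i fi≡0)) (zeroʳ _)

    ∏-nonZero : ∀ {n} (f : Fin n → Carrier) → (∀ i → f i ≢ 0#) → ∏ f ≢ 0#
    ∏-nonZero {zero}  f f≢0 = 1≢0
    ∏-nonZero {suc n} f f≢0 = *-nonZero (f≢0 zero) (∏-nonZero (f ∘ suc) (f≢0 ∘ suc))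

    ∏-one : ∀ {n} → ∏ {n} (λ _ → 1#) ≡ 1#
    ∏-one {zero}  = refl
    ∏-one {suc n} = trans (*-identityˡ _) (∏-one {n})

    segment : Fin (suc k) → ℕ → Fin r → Carrier
    segment i e x = ∏< e (λ l → L i l x)

    ∏-segment-updateAt : ∀ {n} (g : Fin n → Fin (suc k)) (e : Fin n → ℕ) i x →
      ∏ (λ j → segment (g j) (updateAt e i suc j) x) ≡ L (g i) (e i) x * ∏ (λ j → segment (g j) (e j) x)
    ∏-segment-updateAt g e zero    x = *-assoc _ _ _
    ∏-segment-updateAt g e (suc i) x = begin
      s * ∏ (λ j → segment (g (suc j)) (updateAt (e ∘ suc) i suc j) x)
        ≡⟨ cong (s *_) (∏-segment-updateAt (g ∘ suc) (e ∘ suc) i x) ⟩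
      s * (l * p)  ≡⟨ solve 3 (λ s l p → s :* (l :* p) := l :* (s :* p)) refl s l p ⟩
      l * (s * p)  ∎
      where
      s = segment (g zero) (e zero) x
      l = L (g (suc i)) (e (suc i)) x
      p = ∏ (λ j → segment (g (suc j)) (e (suc j)) x)

    segment-D+ : ∀ i e x → segment i (D ℕ.+ e) x ≡ segment i D x * segment i e x
    segment-D+ i zero x = trans (cong (λ z → segment i z x) (ℕ.+-identityʳ D)) (sym (*-identityʳ _))
    segment-D+ i (suc e) x = begin
      segment i (D ℕ.+ suc e) x                      ≡⟨ cong (λ z → segment i z x) (ℕ.+-suc D e) ⟩
      L i (D ℕ.+ e) x * segment i (D ℕ.+ e) x        ≡⟨ cong₂ _*_ (L-periodic i e x) (segment-D+ i e x) ⟩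
      L i e x * (segment i D x * segment i e x)      ≡⟨ solve 3 (λ l n s → l :* (n :* s) := n :* (l :* s)) refl (L i e x) (segment i D x) (segment i e x) ⟩
      segment i D x * segment i (suc e) x            ∎

    segment-*D+ : ∀ i f e x → segment i (f ℕ.* D ℕ.+ e) x ≡ segment i D x ^ f * segment i e x
    segment-*D+ i zero e x = sym (*-identityˡ _)
    segment-*D+ i (suc f) e x = begin
      segment i (D ℕ.+ f ℕ.* D ℕ.+ e) x                     ≡⟨ cong (λ z → segment i z x) (ℕ.+-assoc D (f ℕ.* D) e) ⟩
      segment i (D ℕ.+ (f ℕ.* D ℕ.+ e)) x                   ≡⟨ segment-D+ i (f ℕ.* D ℕ.+ e) x ⟩
      segment i D x * segment i (f ℕ.* D ℕ.+ e) x           ≡⟨ cong (segment i D x *_) (segment-*D+ i f e x) ⟩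
      segment i D x * (segment i D x ^ f * segment i e x)   ≡⟨ *-assoc _ _ _ ⟨
      segment i D x ^ suc f * segment i e x                 ∎

    monomial : (Fin (suc k) → ℕ) → Fin r → Carrier
    monomial e x = ∏ (λ i → segment i (e i) x)

    digits : Fin (D ℕ.^ k) → Fin k → ℕ
    digits b i = toℕ (finToFun {D} {k} b i)

    -- The exponent of row 0 fills the degree up to `r`. If the digits already exceed `r`, truncated
    -- subtraction makes it 0; this is harmless, since only the number of spanning functions counts.
    basis : Fin (D ℕ.^ k) → Fin r → Carrier
    basis b x = segment zero (r ℕ.∸ total (digits b)) x * ∏ (λ i → segment (suc i) (digits b i) x)

    InSpan : (Fin r → Carrier) → Set
    InSpan φ = ∃ λ (α : Fin (D ℕ.^ k) → Carrier) → ∀ x → φ x ≡ α · (λ b → basis b x)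

    inSpan-cong : ∀ {φ ψ} → φ ≗ ψ → InSpan ψ → InSpan φ
    inSpan-cong φ≗ψ (α , spec) = α , λ x → trans (φ≗ψ x) (spec x)

    inSpan-basis : ∀ b → InSpan (basis b)
    inSpan-basis b = δ b , λ x → sym (δ-· b (λ b → basis b x))

    inSpan-combination : ∀ {n} (a : Fin n → Carrier) (φ : Fin n → Fin r → Carrier) →
      (∀ i → InSpan (φ i)) → InSpan (λ x → a · (λ i → φ i x))
    inSpan-combination {n} a φ span = (λ b → sum λ i → a i * proj₁ (span i) b) , λ x → begin
      sum (λ i → a i * φ i x)
        ≡⟨ sum-cong-≗ (λ i → cong (a i *_) (proj₂ (span i) x)) ⟩
      sum (λ i → a i * sum λ b → proj₁ (span i) b * basis b x)
        ≡⟨ sum-cong-≗ (λ i → *-distribˡ-sum (a i) (λ b → proj₁ (span i) b * basis b x)) ⟩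
      sum (λ i → sum λ b → a i * (proj₁ (span i) b * basis b x))
        ≡⟨ ∑-comm {n} {D ℕ.^ k} (λ i b → a i * (proj₁ (span i) b * basis b x)) ⟩
      sum (λ b → sum λ i → a i * (proj₁ (span i) b * basis b x))
        ≡⟨ sum-cong-≗ (λ b → sum-cong-≗ λ i → *-assoc (a i) (proj₁ (span i) b) (basis b x)) ⟨
      sum (λ b → sum λ i → a i * proj₁ (span i) b * basis b x)
        ≡⟨ sum-cong-≗ (λ b → *-distribʳ-sum (basis b x) (λ i → a i * proj₁ (span i) b)) ⟨
      sum (λ b → (sum λ i → a i * proj₁ (span i) b) * basis b x) ∎

    -- The points satisfy k equations of degree D, one for each row other than row 0: its norm
    -- equals the norm of row 0.
    module _ (norms-agree : ∀ i x → segment (suc i) D x ≡ segment zero D x) where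

      ∏-segment-% : ∀ {n} (g : Fin n → Fin k) (e : Fin n → ℕ) x →
        ∏ (λ i → segment (suc (g i)) (e i) x) ≡
        segment zero D x ^ total (λ i → e i / D) * ∏ (λ i → segment (suc (g i)) (e i % D) x)
      ∏-segment-% {zero}  g e x = sym (*-identityˡ 1#)
      ∏-segment-% {suc n} g e x = begin
        segment (suc (g zero)) (e zero) x * ∏ (λ i → segment (suc (g (suc i))) (e (suc i)) x)
          ≡⟨ cong₂ _*_ head (∏-segment-% (g ∘ suc) (e ∘ suc) x) ⟩
        N ^ a * s * (N ^ b * p)
          ≡⟨ solve 4 (λ u s v p → u :* s :* (v :* p) := u :* v :* (s :* p)) refl (N ^ a) s (N ^ b) p ⟩
        N ^ a * N ^ b * (s * p)
          ≡⟨ cong (_* (s * p)) (^-homo-* N a b) ⟨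
        N ^ (a ℕ.+ b) * (s * p) ∎
        where
        N = segment zero D x
        a = e zero / D
        b = total (λ i → e (suc i) / D)
        s = segment (suc (g zero)) (e zero % D) x
        p = ∏ (λ i → segment (suc (g (suc i))) (e (suc i) % D) x)
        head : segment (suc (g zero)) (e zero) x ≡ N ^ a * s
        head = begin
          segment (suc (g zero)) (e zero) x
            ≡⟨ cong (λ z → segment (suc (g zero)) z x) (trans (m≡m%n+[m/n]*n (e zero) D) (ℕ.+-comm (e zero % D) _)) ⟩
          segment (suc (g zero)) (a ℕ.* D ℕ.+ e zero % D) x
            ≡⟨ segment-*D+ (suc (g zero)) a (e zero % D) x ⟩
          segment (suc (g zero)) D x ^ a * s
            ≡⟨ cong (λ z → z ^ a * s) (norms-agree (g zero) x) ⟩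
          N ^ a * s ∎

      total-% : ∀ {n} (e : Fin n → ℕ) → total (λ i → e i / D) ℕ.* D ℕ.+ total (λ i → e i % D) ≡ total e
      total-% {zero} e = refl
      total-% {suc n} e = begin
        (a ℕ.+ b) ℕ.* D ℕ.+ (c ℕ.+ d)         ≡⟨ ℕs.solve 5 (λ a b D c d → (a ℕs.:+ b) ℕs.:* D ℕs.:+ (c ℕs.:+ d) ℕs.:= (c ℕs.:+ a ℕs.:* D) ℕs.:+ (b ℕs.:* D ℕs.:+ d)) refl a b D c d ⟩
        (c ℕ.+ a ℕ.* D) ℕ.+ (b ℕ.* D ℕ.+ d)   ≡⟨ cong₂ ℕ._+_ (m≡m%n+[m/n]*n (e zero) D) (sym (total-% (e ∘ suc))) ⟨
        e zero ℕ.+ total (e ∘ suc)            ∎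
        where
        module ℕs = ℕSolver.+-*-Solver
        a = e zero / D
        b = total (λ i → e (suc i) / D)
        c = e zero % D
        d = total (λ i → e (suc i) % D)

      -- A full period of D factors from a row is its norm, which may be traded for the norm of row
      -- 0, a product of equally many forms. The degree is preserved, so the remainders modulo D
      -- determine the exponent of row 0.
      monomial≡basis : ∀ e → total e ≡ r → ∃ λ b → monomial e ≗ basis b
      monomial≡basis e total≡r = b , λ x → begin
        segment zero (e zero) x * ∏ (λ i → segment (suc i) (e (suc i)) x)
          ≡⟨ cong (segment zero (e zero) x *_) (∏-segment-% id (e ∘ suc) x) ⟩
        segment zero (e zero) x * (segment zero D x ^ f * ∏ (λ i → segment (suc i) (e (suc i) % D) x))
          ≡⟨ solve 3 (λ s n p → s :* (n :* p) := n :* s :* p) refl (segment zero (e zero) x) (segment zero D x ^ f) _ ⟩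
        segment zero D x ^ f * segment zero (e zero) x * ∏ (λ i → segment (suc i) (e (suc i) % D) x)
          ≡⟨ cong₂ _*_ (sym (segment-*D+ zero f (e zero) x)) (∏-cong λ i → cong (λ z → segment (suc i) z x) (sym (digit i))) ⟩
        segment zero (f ℕ.* D ℕ.+ e zero) x * ∏ (λ i → segment (suc i) (digits b i) x)
          ≡⟨ cong (λ z → segment zero z x * ∏ (λ i → segment (suc i) (digits b i) x)) exponent ⟩
        basis b x ∎
        where
        f = total (λ i → e (suc i) / D)
        b = funToFin (λ i → e (suc i) mod D)
        digit : ∀ i → digits b i ≡ e (suc i) % D
        digit i = trans (cong toℕ (Fin.finToFun-funToFin (λ i → e (suc i) mod D) i)) (Fin.toℕ-fromℕ< (m%n<n (e (suc i)) D))
        exponent : f ℕ.* D ℕ.+ e zero ≡ r ℕ.∸ total (digits b)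
        exponent = begin
          f ℕ.* D ℕ.+ e zero                                         ≡⟨ ℕ.m+n∸n≡m _ (total (digits b)) ⟨
          f ℕ.* D ℕ.+ e zero ℕ.+ total (digits b) ℕ.∸ total (digits b)  ≡⟨ cong (ℕ._∸ total (digits b)) rearrange ⟩
          r ℕ.∸ total (digits b)                                     ∎
          where
          rearrange : f ℕ.* D ℕ.+ e zero ℕ.+ total (digits b) ≡ r
          rearrange = begin
            f ℕ.* D ℕ.+ e zero ℕ.+ total (digits b)                      ≡⟨ cong (f ℕ.* D ℕ.+ e zero ℕ.+_) (total-cong digit) ⟩
            f ℕ.* D ℕ.+ e zero ℕ.+ total (λ i → e (suc i) % D)           ≡⟨ cong (ℕ._+ total (λ i → e (suc i) % D)) (ℕ.+-comm (f ℕ.* D) (e zero)) ⟩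
            e zero ℕ.+ f ℕ.* D ℕ.+ total (λ i → e (suc i) % D)           ≡⟨ ℕ.+-assoc (e zero) _ _ ⟩
            e zero ℕ.+ (f ℕ.* D ℕ.+ total (λ i → e (suc i) % D))         ≡⟨ cong (e zero ℕ.+_) (total-% (e ∘ suc)) ⟩
            e zero ℕ.+ total (e ∘ suc)                                   ≡⟨ total≡r ⟩
            r                                                            ∎

      -- The next factor is expanded in the forms `L i (e i)`, exactly those by which the monomial
      -- can grow. Each term is then a monomial with one exponent raised, and the total degree stays
      -- `r`. This is why spanning is required for every exponent vector.
      inSpan-product : ∀ z {a} (w : Fin a → Fin r) e → a ℕ.+ total e ≡ r →
        InSpan (λ x → ∏ (λ j → ℓ z (w j) x) * monomial e x)
      inSpan-product z {zero} w e total≡r with monomial≡basis e total≡r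
      ... | b , eq = inSpan-cong (λ x → trans (*-identityˡ _) (eq x)) (inSpan-basis b)
      inSpan-product z {suc a} w e total≡r with ℓ-spanned e z (w zero)
      ... | α , ℓ≡ = inSpan-cong expand (inSpan-combination α
        (λ i x → p x * monomial (updateAt e i suc) x)
        (λ i → inSpan-product z (w ∘ suc) (updateAt e i suc)
          (trans (cong (a ℕ.+_) (total-updateAt-suc e i)) (trans (ℕ.+-suc a (total e)) total≡r))))
        where
        p : Fin r → Carrier
        p x = ∏ (λ j → ℓ z (w (suc j)) x)
        expand : ∀ x → ℓ z (w zero) x * p x * monomial e x ≡ α · (λ i → p x * monomial (updateAt e i suc) x)
        expand x = begin
          ℓ z (w zero) x * p x * monomial e x
            ≡⟨ *-assoc _ _ _ ⟩
          ℓ z (w zero) x * (p x * monomial e x)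
            ≡⟨ cong (_* (p x * monomial e x)) (ℓ≡ x) ⟩
          (α · λ i → L i (e i) x) * (p x * monomial e x)
            ≡⟨ *-distribʳ-sum (p x * monomial e x) (λ i → α i * L i (e i) x) ⟩
          sum (λ i → α i * L i (e i) x * (p x * monomial e x))
            ≡⟨ sum-cong-≗ (λ i → solve 4 (λ a l p m → a :* l :* (p :* m) := a :* (p :* (l :* m))) refl (α i) (L i (e i) x) (p x) (monomial e x)) ⟩
          sum (λ i → α i * (p x * (L i (e i) x * monomial e x)))
            ≡⟨ sum-cong-≗ (λ i → cong (λ m → α i * (p x * m)) (∏-segment-updateAt id e i x)) ⟨
          sum (λ i → α i * (p x * monomial (updateAt e i suc) x)) ∎

      -- The product runs over all `w`, including `z` itself, to have degree exactly `r`. It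
      -- vanishes at every point other than `z`. The empty monomial brings it into the shape of
      -- `inSpan-product`.
      indicator : Fin r → Fin r → Carrier
      indicator z x = ∏ (λ w → ℓ z w x) * monomial (λ _ → 0) x

      indicator≡ : ∀ z x → indicator z x ≡ ∏ (λ w → ℓ z w x)
      indicator≡ z x = trans (cong (∏ (λ w → ℓ z w x) *_) (∏-one {suc k})) (*-identityʳ _)

      everything-inSpan : ∀ v → InSpan v
      everything-inSpan v = inSpan-cong collapse (inSpan-combination c indicator
        (λ z → inSpan-product z id (λ _ → 0) (trans (cong (r ℕ.+_) (total-zero (suc k))) (ℕ.+-identityʳ r))))
        where
        u : ∀ z → ∃ λ y → ∏ (λ w → ℓ z w z) * y ≡ 1#
        u z = inverse _ (∏-nonZero _ (ℓ-nonZero z))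
        c : Fin r → Carrier
        c z = v z * proj₁ (u z)
        collapse : ∀ x → v x ≡ c · (λ z → indicator z x)
        collapse x = sym (begin
          c · (λ z → indicator z x)
            ≡⟨ sum-single (λ z → c z * indicator z x) x (λ z z≢x →
                 trans (cong (c z *_) (trans (indicator≡ z x) (∏-zero _ x (ℓ-zero (z≢x ∘ sym))))) (zeroʳ (c z))) ⟩
          v x * proj₁ (u x) * indicator x x
            ≡⟨ cong (v x * proj₁ (u x) *_) (indicator≡ x x) ⟩
          v x * proj₁ (u x) * ∏ (λ w → ℓ x w x)
            ≡⟨ solve 3 (λ v u p → v :* u :* p := v :* (p :* u)) refl (v x) (proj₁ (u x)) _ ⟩
          v x * (∏ (λ w → ℓ x w x) * proj₁ (u x))
            ≡⟨ cong (v x *_) (proj₂ (u x)) ⟩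
          v x * 1#
            ≡⟨ *-identityʳ (v x) ⟩
          v x ∎)

      -- Counting replaces a dimension argument: each of the Q^r functions on the points is
      -- determined by its vector of D^k coefficients.
      coefficients : Fin (Q ℕ.^ r) → Fin (Q ℕ.^ (D ℕ.^ k))
      coefficients a = funToFin (index ∘ proj₁ (everything-inSpan (element ∘ finToFun a)))

      coefficients-injective : ∀ {a b} → coefficients a ≡ coefficients b → a ≡ b
      coefficients-injective {a} {b} eq = finToFun-injective a b λ x → begin
        finToFun a x                        ≡⟨ index-element _ ⟨
        index (element (finToFun a x))      ≡⟨ cong index (values x) ⟩
        index (element (finToFun b x))      ≡⟨ index-element _ ⟩
        finToFun b x                        ∎
        where
        α β : Fin (D ℕ.^ k) → Carrier
        α = proj₁ (everything-inSpan (element ∘ finToFun a))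
        β = proj₁ (everything-inSpan (element ∘ finToFun b))
        α≗β : α ≗ β
        α≗β j = begin
          α j                               ≡⟨ element-index _ ⟨
          element (index (α j))             ≡⟨ cong element (Fin.finToFun-funToFin (index ∘ α) j) ⟨
          element (finToFun (coefficients a) j)  ≡⟨ cong (λ z → element (finToFun z j)) eq ⟩
          element (finToFun (coefficients b) j)  ≡⟨ cong element (Fin.finToFun-funToFin (index ∘ β) j) ⟩
          element (index (β j))             ≡⟨ element-index _ ⟩
          β j                               ∎
        values : ∀ x → element (finToFun a x) ≡ element (finToFun b x)
        values x = begin
          element (finToFun a x)    ≡⟨ proj₂ (everything-inSpan (element ∘ finToFun a)) x ⟩
          α · (λ j → basis j x)     ≡⟨ sum-cong-≗ (λ j → cong (_* basis j x) (α≗β j)) ⟩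
          β · (λ j → basis j x)     ≡⟨ proj₂ (everything-inSpan (element ∘ finToFun b)) x ⟨
          element (finToFun b x)    ∎

      1<Q : 1 ℕ.< Q
      1<Q = ℕ.≰⇒> λ Q≤1 → 1≢0 (begin
        1#                   ≡⟨ element-index 1# ⟨
        element (index 1#)   ≡⟨ cong element (same Q≤1 (index 1#) (index 0#)) ⟩
        element (index 0#)   ≡⟨ element-index 0# ⟩
        0#                   ∎)
        where
        same : ∀ {n} → n ℕ.≤ 1 → (i j : Fin n) → i ≡ j
        same (s≤s z≤n) zero zero = refl

      points≤D^k : r ℕ.≤ D ℕ.^ k
      points≤D^k = ℕ.≮⇒≥ λ D^k<r → ℕ.<⇒≱ (ℕ.^-monoʳ-< Q 1<Q D^k<r) (Fin.injective⇒≤ coefficients-injective)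

-- Finite fields: Frobenius, prime fields and quadratic extensions

injective⇒surjective : ∀ {n} (f : Fin n → Fin n) → (∀ {i j} → f i ≡ f j → i ≡ j) → ∀ y → ∃ λ x → f x ≡ y
injective⇒surjective {suc n} f f-inj y with Fin.any? (λ x → f x Fin.≟ y)
... | yes hit = hit
... | no miss = contradiction (Fin.injective⇒≤ avoid-inj) ℕ.1+n≰n
  where
  y≢ : ∀ x → y ≢ f x
  y≢ x y≡fx = miss (x , sym y≡fx)
  avoid-inj : ∀ {i j} → punchOut (y≢ i) ≡ punchOut (y≢ j) → i ≡ j
  avoid-inj {i} {j} eq = f-inj (Fin.punchOut-injective (y≢ i) (y≢ j) eq)

module Frobenius (F : Field) where
  open import Data.Nat.Combinatorics using (_C_; nCn≡1)
  open FieldProperties F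
  open import Algebra.Properties.CommutativeSemiring.Binomial commutativeSemiring using (theorem; binomialTerm)
  open import Algebra.Properties.Monoid.Sum +-monoid using (sum-init-last)
  open ≡-Reasoning

  n⋆0≡0 : ∀ n → n ⋆ 0# ≡ 0#
  n⋆0≡0 zero    = refl
  n⋆0≡0 (suc n) = trans (+-identityˡ _) (n⋆0≡0 n)

  multiple⋆≡0 : ∀ {p n} x → p ⋆ 1# ≡ 0# → p ∣ n → n ⋆ x ≡ 0#
  multiple⋆≡0 {p} x p⋆1≡0 (divides c refl) = begin
    (c ℕ.* p) ⋆ x     ≡⟨ ×-assocˡ x c p ⟨
    c ⋆ (p ⋆ x)       ≡⟨ cong (λ z → c ⋆ (p ⋆ z)) (*-identityˡ x) ⟨
    c ⋆ (p ⋆ (1# * x)) ≡⟨ cong (c ⋆_) (×-assoc-* p 1# x) ⟨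
    c ⋆ ((p ⋆ 1#) * x) ≡⟨ cong (λ z → c ⋆ (z * x)) p⋆1≡0 ⟩
    c ⋆ (0# * x)      ≡⟨ cong (c ⋆_) (zeroˡ x) ⟩
    c ⋆ 0#            ≡⟨ n⋆0≡0 c ⟩
    0#                ∎

  ^p-distrib-+ : ∀ {p} → Prime p → p ⋆ 1# ≡ 0# → ∀ x y → (x + y) ^ p ≡ x ^ p + y ^ p
  ^p-distrib-+ {zero} pr = contradiction pr ¬prime[0]
  ^p-distrib-+ {p@(suc p-1)} pr p⋆1≡0 x y = begin
    (x + y) ^ p
      ≡⟨ theorem p x y ⟩
    t zero + sum (t ∘ suc)
      ≡⟨ cong (t zero +_) (sum-init-last (t ∘ suc)) ⟩
    t zero + (sum (λ i → t (suc (inject₁ i))) + t (suc (fromℕ p-1)))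
      ≡⟨ cong₂ (λ a b → a + (b + t (suc (fromℕ p-1)))) first (sum-zero _ middle) ⟩
    y ^ p + (0# + t (suc (fromℕ p-1)))
      ≡⟨ cong (y ^ p +_) (trans (+-identityˡ _) last) ⟩
    y ^ p + x ^ p
      ≡⟨ +-comm _ _ ⟩
    x ^ p + y ^ p ∎
    where
    t : Fin (suc p) → Carrier
    t = binomialTerm x y p
    first : t zero ≡ y ^ p
    first = trans (+-identityʳ _) (*-identityˡ _)
    middle : ∀ i → t (suc (inject₁ i)) ≡ 0#
    middle i = multiple⋆≡0 _ p⋆1≡0 (Chebyshev.prime∣nCk _ pr (s≤s z≤n) (s≤s (subst (ℕ._< p-1) (sym (Fin.toℕ-inject₁ i)) (Fin.toℕ<n i))))
    last : t (suc (fromℕ p-1)) ≡ x ^ p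
    last = begin
      (p C suc (toℕ (fromℕ p-1))) ⋆ (x ^ suc (toℕ (fromℕ p-1)) * y ^ (p-1 ℕ.∸ toℕ (fromℕ p-1)))
        ≡⟨ cong (λ z → (p C suc z) ⋆ (x ^ suc z * y ^ (p-1 ℕ.∸ z))) (Fin.toℕ-fromℕ p-1) ⟩
      (p C p) ⋆ (x ^ p * y ^ (p-1 ℕ.∸ p-1))
        ≡⟨ cong₂ (λ a b → a ⋆ (x ^ p * y ^ b)) (nCn≡1 p) (ℕ.n∸n≡0 p-1) ⟩
      x ^ p * 1# + 0#
        ≡⟨ trans (+-identityʳ _) (*-identityʳ _) ⟩
      x ^ p ∎

  ^p^n-distrib-+ : ∀ {p} → Prime p → p ⋆ 1# ≡ 0# → ∀ n x y → (x + y) ^ (p ℕ.^ n) ≡ x ^ (p ℕ.^ n) + y ^ (p ℕ.^ n)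
  ^p^n-distrib-+ pr p⋆1≡0 zero x y = trans (*-identityʳ _) (sym (cong₂ _+_ (*-identityʳ x) (*-identityʳ y)))
  ^p^n-distrib-+ {p} pr p⋆1≡0 (suc n) x y = begin
    (x + y) ^ (p ℕ.* p ℕ.^ n)                       ≡⟨ ^-assocʳ (x + y) p (p ℕ.^ n) ⟨
    ((x + y) ^ p) ^ (p ℕ.^ n)                       ≡⟨ cong (_^ (p ℕ.^ n)) (^p-distrib-+ pr p⋆1≡0 x y) ⟩
    (x ^ p + y ^ p) ^ (p ℕ.^ n)                     ≡⟨ ^p^n-distrib-+ pr p⋆1≡0 n (x ^ p) (y ^ p) ⟩
    (x ^ p) ^ (p ℕ.^ n) + (y ^ p) ^ (p ℕ.^ n)       ≡⟨ cong₂ _+_ (^-assocʳ x p (p ℕ.^ n)) (^-assocʳ y p (p ℕ.^ n)) ⟩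
    x ^ (p ℕ.* p ℕ.^ n) + y ^ (p ℕ.* p ℕ.^ n)       ∎

-- `scalar` lists the prime field, fixed by x ↦ x^p. `half` is the exponent (Q-1)/2 of Euler's
-- criterion. `Q` is kept apart from p^D so that a quadratic extension can be indexed by pairs, with
-- Q * Q elements.
record GaloisField (p D : ℕ) : Set₁ where
  field
    F : Field
  open FieldProperties F
  field
    Q half : ℕ
    Q≡p^D : Q ≡ p ℕ.^ D
    Q-odd : Q ≡ suc (half ℕ.+ half)
    index : Carrier → Fin Q
    element : Fin Q → Carrier
    element-index : ∀ x → element (index x) ≡ x
    index-element : ∀ i → index (element i) ≡ i
    1+1≢0 : 1# + 1# ≢ 0#
    p⋆1≡0 : p ⋆ 1# ≡ 0#
    x^Q≡x : ∀ x → x ^ Q ≡ x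
    scalar : Fin p → Carrier
    scalar-injective : ∀ {i j} → scalar i ≡ scalar j → i ≡ j
    scalar^p : ∀ i → scalar i ^ p ≡ scalar i

  infix 4 _≟_
  _≟_ : (x y : Carrier) → Dec (x ≡ y)
  x ≟ y = map′ (λ eq → trans (sym (element-index x)) (trans (cong element eq) (element-index y))) (cong index) (index x Fin.≟ index y)

  -- If every element had a square root, choosing one would be injective, hence surjective by
  -- finiteness: every x would be the chosen root of x². Since 1 and -1 have the same square, they
  -- would coincide.
  nonSquare : ∃ λ ν → ∀ x → x * x ≢ ν
  nonSquare with Fin.any? (λ i → ¬? (Fin.any? λ j → element j * element j ≟ element i))
  ... | yes (i , none) = element i , λ x x²≡ → none (index x , trans (cong₂ _*_ (element-index x) (element-index x)) x²≡)
  ... | no all = contradiction 1≡-1 λ 1≡-1 → 1+1≢0 (trans (cong (1# +_) 1≡-1) (-‿inverseʳ 1#))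
    where
    open ≡-Reasoning
    root : ∀ i → ∃ λ j → element j * element j ≡ element i
    root i with Fin.any? (λ j → element j * element j ≟ element i)
    ... | yes j = j
    ... | no none = contradiction (i , none) all
    root-injective : ∀ {i j} → proj₁ (root i) ≡ proj₁ (root j) → i ≡ j
    root-injective {i} {j} eq = begin
      i                  ≡⟨ index-element i ⟨
      index (element i)  ≡⟨ cong index (trans (sym (proj₂ (root i))) (trans (cong (λ z → element z * element z) eq) (proj₂ (root j)))) ⟩
      index (element j)  ≡⟨ index-element j ⟩
      j                  ∎
    isRoot : ∀ x → ∃ λ i → x * x ≡ element i × element (proj₁ (root i)) ≡ x
    isRoot x with injective⇒surjective (proj₁ ∘ root) root-injective (index x)
    ... | i , eq = i , trans (cong (λ z → z * z) (trans (sym (element-index x)) (cong element (sym eq)))) (proj₂ (root i))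
                     , trans (cong element eq) (element-index x)
    -1*-1≡1*1 : (- 1#) * (- 1#) ≡ 1# * 1#
    -1*-1≡1*1 = begin
      - 1# * - 1#        ≡⟨ -‿distribˡ-* 1# (- 1#) ⟨
      - (1# * - 1#)      ≡⟨ cong (λ z → - z) (-‿distribʳ-* 1# 1#) ⟨
      - (- (1# * 1#))    ≡⟨ -‿involutive _ ⟩
      1# * 1#            ∎
    1≡-1 : 1# ≡ - 1#
    1≡-1 with isRoot 1# | isRoot (- 1#)
    ... | i , 1≡ , i↦ | j , -1≡ , j↦ = trans (sym i↦) (trans (cong (element ∘ proj₁ ∘ root) i≡j) j↦)
      where
      i≡j : i ≡ j
      i≡j = trans (sym (index-element i)) (trans (cong index (trans (sym 1≡) (trans (sym -1*-1≡1*1) -1≡))) (index-element j))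

module PrimeField (p-1 : ℕ) (pr : Prime (suc p-1)) (3≤p : 3 ℕ.≤ suc p-1) where
  open ≡-Reasoning
  p = suc p-1

  [_] : ℕ → Fin p
  [ n ] = n mod p

  [n]-cong : ∀ m n → m % p ≡ n % p → [ m ] ≡ [ n ]
  [n]-cong m n eq = Fin.fromℕ<-cong _ _ eq (m%n<n m p) (m%n<n n p)

  toℕ-[n] : ∀ n → toℕ [ n ] ≡ n % p
  toℕ-[n] n = Fin.toℕ-fromℕ< (m%n<n n p)

  [toℕ] : ∀ x → [ toℕ x ] ≡ x
  [toℕ] x = Fin.toℕ-injective (trans (toℕ-[n] (toℕ x)) (m<n⇒m%n≡m (Fin.toℕ<n x)))

  infixl 6 _⊕_
  infixl 7 _⊗_
  _⊕_ _⊗_ : Fin p → Fin p → Fin p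
  x ⊕ y = [ toℕ x ℕ.+ toℕ y ]
  x ⊗ y = [ toℕ x ℕ.* toℕ y ]
  ⊖_ : Fin p → Fin p
  ⊖ x = [ p ℕ.∸ toℕ x ]

  [+]ˡ : ∀ m n → [ toℕ [ m ] ℕ.+ n ] ≡ [ m ℕ.+ n ]
  [+]ˡ m n = [n]-cong (toℕ [ m ] ℕ.+ n) (m ℕ.+ n) (begin
    (toℕ [ m ] ℕ.+ n) % p               ≡⟨ cong (λ z → (z ℕ.+ n) % p) (toℕ-[n] m) ⟩
    (m % p ℕ.+ n) % p                   ≡⟨ %-distribˡ-+ (m % p) n p ⟩
    (m % p % p ℕ.+ n % p) % p           ≡⟨ cong (λ z → (z ℕ.+ n % p) % p) (m%n%n≡m%n m p) ⟩
    (m % p ℕ.+ n % p) % p               ≡⟨ %-distribˡ-+ m n p ⟨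
    (m ℕ.+ n) % p                       ∎)

  [+]ʳ : ∀ m n → [ m ℕ.+ toℕ [ n ] ] ≡ [ m ℕ.+ n ]
  [+]ʳ m n = trans (cong [_] (ℕ.+-comm m _)) (trans ([+]ˡ n m) (cong [_] (ℕ.+-comm n m)))

  [*]ˡ : ∀ m n → [ toℕ [ m ] ℕ.* n ] ≡ [ m ℕ.* n ]
  [*]ˡ m n = [n]-cong (toℕ [ m ] ℕ.* n) (m ℕ.* n) (begin
    (toℕ [ m ] ℕ.* n) % p               ≡⟨ cong (λ z → (z ℕ.* n) % p) (toℕ-[n] m) ⟩
    (m % p ℕ.* n) % p                   ≡⟨ %-distribˡ-* (m % p) n p ⟩
    (m % p % p ℕ.* (n % p)) % p         ≡⟨ cong (λ z → (z ℕ.* (n % p)) % p) (m%n%n≡m%n m p) ⟩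
    (m % p ℕ.* (n % p)) % p             ≡⟨ %-distribˡ-* m n p ⟨
    (m ℕ.* n) % p                       ∎)

  [*]ʳ : ∀ m n → [ m ℕ.* toℕ [ n ] ] ≡ [ m ℕ.* n ]
  [*]ʳ m n = trans (cong [_] (ℕ.*-comm m _)) (trans ([*]ˡ n m) (cong [_] (ℕ.*-comm n m)))

  ⊕-comm : ∀ x y → x ⊕ y ≡ y ⊕ x
  ⊕-comm x y = cong [_] (ℕ.+-comm (toℕ x) (toℕ y))

  ⊗-comm : ∀ x y → x ⊗ y ≡ y ⊗ x
  ⊗-comm x y = cong [_] (ℕ.*-comm (toℕ x) (toℕ y))

  ⊕-assoc : ∀ x y z → (x ⊕ y) ⊕ z ≡ x ⊕ (y ⊕ z)
  ⊕-assoc x y z = trans ([+]ˡ (toℕ x ℕ.+ toℕ y) (toℕ z)) (trans (cong [_] (ℕ.+-assoc (toℕ x) _ _)) (sym ([+]ʳ (toℕ x) _)))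

  ⊗-assoc : ∀ x y z → (x ⊗ y) ⊗ z ≡ x ⊗ (y ⊗ z)
  ⊗-assoc x y z = trans ([*]ˡ (toℕ x ℕ.* toℕ y) (toℕ z)) (trans (cong [_] (ℕ.*-assoc (toℕ x) _ _)) (sym ([*]ʳ (toℕ x) _)))

  ⊗-distribˡ-⊕ : ∀ x y z → x ⊗ (y ⊕ z) ≡ x ⊗ y ⊕ x ⊗ z
  ⊗-distribˡ-⊕ x y z = begin
    [ a ℕ.* toℕ [ b ℕ.+ c ] ]              ≡⟨ [*]ʳ a (b ℕ.+ c) ⟩
    [ a ℕ.* (b ℕ.+ c) ]                    ≡⟨ cong [_] (ℕ.*-distribˡ-+ a b c) ⟩
    [ a ℕ.* b ℕ.+ a ℕ.* c ]                ≡⟨ [+]ˡ (a ℕ.* b) (a ℕ.* c) ⟨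
    [ toℕ (x ⊗ y) ℕ.+ a ℕ.* c ]            ≡⟨ [+]ʳ (toℕ (x ⊗ y)) (a ℕ.* c) ⟨
    x ⊗ y ⊕ x ⊗ z                          ∎
    where
    a = toℕ x
    b = toℕ y
    c = toℕ z

  ⊕-identityˡ : ∀ x → [ 0 ] ⊕ x ≡ x
  ⊕-identityˡ x = trans ([+]ˡ 0 (toℕ x)) ([toℕ] x)

  ⊗-identityˡ : ∀ x → [ 1 ] ⊗ x ≡ x
  ⊗-identityˡ x = trans ([*]ˡ 1 (toℕ x)) (trans (cong [_] (ℕ.*-identityˡ (toℕ x))) ([toℕ] x))

  [p]≡0 : [ p ] ≡ [ 0 ]
  [p]≡0 = [n]-cong p 0 (n%n≡0 p)

  ⊖-inverseˡ : ∀ x → (⊖ x) ⊕ x ≡ [ 0 ]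
  ⊖-inverseˡ x = trans ([+]ˡ (p ℕ.∸ toℕ x) (toℕ x)) (trans (cong [_] (ℕ.m∸n+n≡m (ℕ.<⇒≤ (Fin.toℕ<n x)))) [p]≡0)

  ⊕-⊗-isCommutativeRing : IsCommutativeRing _≡_ _⊕_ _⊗_ ⊖_ [ 0 ] [ 1 ]
  ⊕-⊗-isCommutativeRing = record
    { isRing = record
      { +-isAbelianGroup = record
        { isGroup = record
          { isMonoid = record
            { isSemigroup = record
              { isMagma = record { isEquivalence = isEquivalence ; ∙-cong = cong₂ _⊕_ }
              ; assoc = ⊕-assoc }
            ; identity = ⊕-identityˡ , λ x → trans (⊕-comm x _) (⊕-identityˡ x) }
          ; inverse = ⊖-inverseˡ , λ x → trans (⊕-comm x _) (⊖-inverseˡ x)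
          ; ⁻¹-cong = cong ⊖_ }
        ; comm = ⊕-comm }
      ; *-cong = cong₂ _⊗_
      ; *-assoc = ⊗-assoc
      ; *-identity = ⊗-identityˡ , λ x → trans (⊗-comm x _) (⊗-identityˡ x)
      ; distrib = ⊗-distribˡ-⊕ , λ x y z → trans (⊗-comm (y ⊕ z) x) (trans (⊗-distribˡ-⊕ x y z) (cong₂ _⊕_ (⊗-comm x y) (⊗-comm x z)))
      }
    ; *-comm = ⊗-comm }

  [n]≡0⇒p∣n : ∀ n → [ n ] ≡ [ 0 ] → p ∣ n
  [n]≡0⇒p∣n n eq = m%n≡0⇒n∣m n p (trans (sym (toℕ-[n] n)) (trans (cong toℕ eq) (toℕ-[n] 0)))

  p∣toℕ⇒≡0 : ∀ x → p ∣ toℕ x → x ≡ [ 0 ]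
  p∣toℕ⇒≡0 x p∣x with toℕ x in eq
  ... | zero  = Fin.toℕ-injective (trans eq (sym (toℕ-[n] 0)))
  ... | suc n = contradiction (∣⇒≤ p∣x) (ℕ.<⇒≱ (subst (ℕ._< p) eq (Fin.toℕ<n x)))

  ⊗-injective : ∀ x → x ≢ [ 0 ] → ∀ {y z} → x ⊗ y ≡ x ⊗ z → y ≡ z
  ⊗-injective x x≢0 {y} {z} eq with euclidsLemma (toℕ x) (toℕ (y ⊕ (⊖ z))) pr ([n]≡0⇒p∣n _ (begin
    x ⊗ (y ⊕ (⊖ z))          ≡⟨ ⊗-distribˡ-⊕ x y (⊖ z) ⟩
    x ⊗ y ⊕ x ⊗ (⊖ z)        ≡⟨ cong (_⊕ x ⊗ (⊖ z)) eq ⟩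
    x ⊗ z ⊕ x ⊗ (⊖ z)        ≡⟨ ⊗-distribˡ-⊕ x z (⊖ z) ⟨
    x ⊗ (z ⊕ (⊖ z))          ≡⟨ cong (x ⊗_) (trans (⊕-comm z (⊖ z)) (⊖-inverseˡ z)) ⟩
    x ⊗ [ 0 ]                ≡⟨ ⊗-comm x [ 0 ] ⟩
    [ 0 ] ⊗ x                ≡⟨ [*]ˡ 0 (toℕ x) ⟩
    [ 0 ]                    ∎))
  ... | inj₁ d = contradiction (p∣toℕ⇒≡0 x d) x≢0
  ... | inj₂ d = begin
    y                        ≡⟨ ⊕-identityˡ y ⟨
    [ 0 ] ⊕ y                ≡⟨ cong (_⊕ y) (⊖-inverseˡ z) ⟨
    (⊖ z) ⊕ z ⊕ y            ≡⟨ cong (_⊕ y) (⊕-comm (⊖ z) z) ⟩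
    z ⊕ (⊖ z) ⊕ y            ≡⟨ ⊕-assoc z (⊖ z) y ⟩
    z ⊕ ((⊖ z) ⊕ y)          ≡⟨ cong (z ⊕_) (trans (⊕-comm (⊖ z) y) (p∣toℕ⇒≡0 _ d)) ⟩
    z ⊕ [ 0 ]                ≡⟨ trans (⊕-comm z [ 0 ]) (⊕-identityˡ z) ⟩
    z                        ∎

  [n]≢0 : ∀ n → 1 ℕ.≤ n → n ℕ.< p → [ n ] ≢ [ 0 ]
  [n]≢0 (suc n) _ n<p eq = contradiction (∣⇒≤ ([n]≡0⇒p∣n (suc n) eq)) (ℕ.<⇒≱ n<p)

  field′ : Field
  field′ = record
    { isCommutativeRing = ⊕-⊗-isCommutativeRing
    ; 1≢0 = [n]≢0 1 (s≤s z≤n) (ℕ.≤-trans (s≤s (s≤s z≤n)) 3≤p)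
    ; inverse = λ x x≢0 → injective⇒surjective (x ⊗_) (⊗-injective x x≢0) [ 1 ]
    }

  open FieldProperties field′ using (_⋆_; _^_; 1#; 0#; _+_; zeroˡ; 1^n≡1)

  n⋆1≡[n] : ∀ n → n ⋆ 1# ≡ [ n ]
  n⋆1≡[n] zero    = refl
  n⋆1≡[n] (suc n) = trans (cong ([ 1 ] ⊕_) (n⋆1≡[n] n)) (trans ([+]ˡ 1 (toℕ [ n ])) ([+]ʳ 1 n))

  p⋆1≡0 : p ⋆ 1# ≡ 0#
  p⋆1≡0 = trans (n⋆1≡[n] p) [p]≡0

  -- Fermat's little theorem by induction on `n`, from the additivity of the p-th power.
  [n]^p : ∀ n → [ n ] ^ p ≡ [ n ]
  [n]^p zero    = zeroˡ (0# ^ p-1)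
  [n]^p (suc n) = begin
    [ suc n ] ^ p             ≡⟨ cong (_^ p) split ⟩
    (1# + [ n ]) ^ p          ≡⟨ Frobenius.^p-distrib-+ field′ pr p⋆1≡0 1# [ n ] ⟩
    1# ^ p + [ n ] ^ p        ≡⟨ cong₂ _+_ (1^n≡1 p) ([n]^p n) ⟩
    1# + [ n ]                ≡⟨ split ⟨
    [ suc n ]                 ∎
    where
    split : [ suc n ] ≡ [ 1 ] ⊕ [ n ]
    split = sym (trans ([+]ˡ 1 (toℕ [ n ])) ([+]ʳ 1 n))

  fermat : ∀ x → x ^ p ≡ x
  fermat x = trans (cong (_^ p) (sym ([toℕ] x))) (trans ([n]^p (toℕ x)) ([toℕ] x))

  p-odd : p % 2 ≡ 1
  p-odd with p % 2 in eq | m%n<n p 2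
  ... | 0 | _ with prime⇒irreducible pr (m%n≡0⇒n∣m p 2 eq)
  ...   | inj₁ ()
  ...   | inj₂ 2≡p = contradiction (subst (3 ℕ.≤_) (sym 2≡p) 3≤p) λ { (s≤s (s≤s ())) }
  p-odd | 1 | _ = refl
  p-odd | suc (suc _) | s≤s (s≤s ())

  galoisField : GaloisField p 1
  galoisField = record
    { F = field′
    ; Q = p
    ; half = p / 2
    ; Q≡p^D = sym (ℕ.*-identityʳ p)
    ; Q-odd = trans (m≡m%n+[m/n]*n p 2) (cong₂ ℕ._+_ p-odd (trans (ℕ.*-comm (p / 2) 2) (cong (p / 2 ℕ.+_) (ℕ.+-identityʳ (p / 2)))))
    ; index = id
    ; element = id
    ; element-index = λ _ → refl
    ; index-element = λ _ → refl
    ; 1+1≢0 = λ eq → [n]≢0 2 (s≤s z≤n) 3≤p (trans (sym (trans ([+]ˡ 1 (toℕ [ 1 ])) ([+]ʳ 1 1))) eq)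
    ; p⋆1≡0 = p⋆1≡0
    ; x^Q≡x = fermat
    ; scalar = id
    ; scalar-injective = id
    ; scalar^p = fermat
    }

module QuadraticExtension {p D} (pr : Prime p) (G : GaloisField p D) where
  open GaloisField G
  open FieldProperties F
  open import Algebra.Solver.Ring.NaturalCoefficients.Default commutativeSemiring
    using (solve; _:*_; _:+_; _:=_; con)
  open ≡-Reasoning

  ν : Carrier
  ν = proj₁ nonSquare

  K : Set
  K = Carrier × Carrier

  infixl 6 _⊕_
  infixl 7 _⊗_
  _⊕_ _⊗_ : K → K → K
  (a , b) ⊕ (c , d) = a + c , b + d
  (a , b) ⊗ (c , d) = a * c + ν * (b * d) , a * d + b * c
  ⊖_ : K → K
  ⊖ (a , b) = - a , - b

  ⊕-comm : ∀ x y → x ⊕ y ≡ y ⊕ x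
  ⊕-comm (a , b) (c , d) = cong₂ _,_ (+-comm a c) (+-comm b d)

  ⊗-comm : ∀ x y → x ⊗ y ≡ y ⊗ x
  ⊗-comm (a , b) (c , d) = cong₂ _,_
    (solve 5 (λ ν a b c d → a :* c :+ ν :* (b :* d) := c :* a :+ ν :* (d :* b)) refl ν a b c d)
    (solve 4 (λ a b c d → a :* d :+ b :* c := c :* b :+ d :* a) refl a b c d)

  ⊗-assoc : ∀ x y z → (x ⊗ y) ⊗ z ≡ x ⊗ (y ⊗ z)
  ⊗-assoc (a , b) (c , d) (e , f) = cong₂ _,_
    (solve 7 (λ ν a b c d e f → (a :* c :+ ν :* (b :* d)) :* e :+ ν :* ((a :* d :+ b :* c) :* f)
       := a :* (c :* e :+ ν :* (d :* f)) :+ ν :* (b :* (c :* f :+ d :* e))) refl ν a b c d e f)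
    (solve 7 (λ ν a b c d e f → (a :* c :+ ν :* (b :* d)) :* f :+ (a :* d :+ b :* c) :* e
       := a :* (c :* f :+ d :* e) :+ b :* (c :* e :+ ν :* (d :* f))) refl ν a b c d e f)

  ⊗-distribˡ-⊕ : ∀ x y z → x ⊗ (y ⊕ z) ≡ x ⊗ y ⊕ x ⊗ z
  ⊗-distribˡ-⊕ (a , b) (c , d) (e , f) = cong₂ _,_
    (solve 7 (λ ν a b c d e f → a :* (c :+ e) :+ ν :* (b :* (d :+ f))
       := (a :* c :+ ν :* (b :* d)) :+ (a :* e :+ ν :* (b :* f))) refl ν a b c d e f)
    (solve 6 (λ a b c d e f → a :* (d :+ f) :+ b :* (c :+ e) := (a :* d :+ b :* c) :+ (a :* f :+ b :* e)) refl a b c d e f)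

  ⊗-identityˡ : ∀ x → (1# , 0#) ⊗ x ≡ x
  ⊗-identityˡ (a , b) = cong₂ _,_
    (solve 3 (λ ν a b → con 1 :* a :+ ν :* (con 0 :* b) := a) refl ν a b)
    (solve 2 (λ a b → con 1 :* b :+ con 0 :* a := b) refl a b)

  ⊕-⊗-isCommutativeRing : IsCommutativeRing _≡_ _⊕_ _⊗_ ⊖_ (0# , 0#) (1# , 0#)
  ⊕-⊗-isCommutativeRing = record
    { isRing = record
      { +-isAbelianGroup = record
        { isGroup = record
          { isMonoid = record
            { isSemigroup = record
              { isMagma = record { isEquivalence = isEquivalence ; ∙-cong = cong₂ _⊕_ }
              ; assoc = λ (a , b) (c , d) (e , f) → cong₂ _,_ (+-assoc a c e) (+-assoc b d f) }
            ; identity = (λ (a , b) → cong₂ _,_ (+-identityˡ a) (+-identityˡ b))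
                       , (λ (a , b) → cong₂ _,_ (+-identityʳ a) (+-identityʳ b)) }
          ; inverse = (λ (a , b) → cong₂ _,_ (-‿inverseˡ a) (-‿inverseˡ b))
                    , (λ (a , b) → cong₂ _,_ (-‿inverseʳ a) (-‿inverseʳ b))
          ; ⁻¹-cong = cong ⊖_ }
        ; comm = ⊕-comm }
      ; *-cong = cong₂ _⊗_
      ; *-assoc = ⊗-assoc
      ; *-identity = ⊗-identityˡ , λ x → trans (⊗-comm x _) (⊗-identityˡ x)
      ; distrib = ⊗-distribˡ-⊕ , λ x y z → trans (⊗-comm (y ⊕ z) x) (trans (⊗-distribˡ-⊕ x y z) (cong₂ _⊕_ (⊗-comm x y) (⊗-comm x z)))
      }
    ; *-comm = ⊗-comm }

  -- The norm a² - νb² of a + b√ν. Putting the sign on one factor lets the semiring solver treat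
  -- `- b` as a variable.
  norm : K → Carrier
  norm (a , b) = a * a + ν * (b * - b)

  -- For b ≠ 0, a vanishing norm would make ν the square of a/b.
  norm≢0 : ∀ x → x ≢ (0# , 0#) → norm x ≢ 0#
  norm≢0 (a , b) x≢0 norm≡0 with b ≟ 0#
  ... | yes refl = *-nonZero a≢0 a≢0 (begin
    a * a                     ≡⟨ solve 3 (λ ν a c → a :* a := a :* a :+ ν :* (con 0 :* c)) refl ν a (- 0#) ⟩
    a * a + ν * (0# * - 0#)   ≡⟨ norm≡0 ⟩
    0#                        ∎)
    where
    a≢0 : a ≢ 0#
    a≢0 a≡0 = x≢0 (cong (_, 0#) a≡0)
  ... | no b≢0 with inverse b b≢0
  ...   | i , bi≡1 = proj₂ nonSquare (a * i) (begin
    a * i * (a * i)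
      ≡⟨ solve 4 (λ ν a b i → a :* i :* (a :* i) := (a :* a :+ ν :* (b :* con 0)) :* (i :* i)) refl ν a b i ⟩
    (a * a + ν * (b * 0#)) * (i * i)
      ≡⟨ cong (λ z → (a * a + ν * (b * z)) * (i * i)) (-‿inverseˡ b) ⟨
    (a * a + ν * (b * (- b + b))) * (i * i)
      ≡⟨ solve 5 (λ ν a b c i → (a :* a :+ ν :* (b :* (c :+ b))) :* (i :* i)
           := (a :* a :+ ν :* (b :* c)) :* (i :* i) :+ ν :* (b :* i :* (b :* i))) refl ν a b (- b) i ⟩
    norm (a , b) * (i * i) + ν * (b * i * (b * i))
      ≡⟨ cong₂ (λ n z → n * (i * i) + ν * (z * z)) norm≡0 bi≡1 ⟩
    0# * (i * i) + ν * (1# * 1#)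
      ≡⟨ solve 2 (λ i ν → con 0 :* (i :* i) :+ ν :* (con 1 :* con 1) := ν) refl i ν ⟩
    ν ∎)

  ⊗-inverse : ∀ x → x ≢ (0# , 0#) → ∃ λ y → x ⊗ y ≡ (1# , 0#)
  ⊗-inverse x@(a , b) x≢0 with inverse (norm x) (norm≢0 x x≢0)
  ... | i , ni≡1 = (a * i , - b * i) , cong₂ _,_
    (trans (solve 5 (λ ν a b c i → a :* (a :* i) :+ ν :* (b :* (c :* i)) := (a :* a :+ ν :* (b :* c)) :* i) refl ν a b (- b) i) ni≡1)
    (begin
      a * (- b * i) + b * (a * i)   ≡⟨ solve 4 (λ a b c i → a :* (c :* i) :+ b :* (a :* i) := a :* i :* (c :+ b)) refl a b (- b) i ⟩
      a * i * (- b + b)             ≡⟨ cong (a * i *_) (-‿inverseˡ b) ⟩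
      a * i * 0#                    ≡⟨ zeroʳ _ ⟩
      0#                            ∎)

  extension : Field
  extension = record
    { isCommutativeRing = ⊕-⊗-isCommutativeRing
    ; 1≢0 = 1≢0 ∘ ,-injectiveˡ
    ; inverse = ⊗-inverse
    }

  private module E = FieldProperties extension

  embedded⋆ : ∀ n → n E.⋆ E.1# ≡ (n ⋆ 1# , 0#)
  embedded⋆ zero    = refl
  embedded⋆ (suc n) = trans (cong (E.1# ⊕_) (embedded⋆ n)) (cong (1# + n ⋆ 1# ,_) (+-identityʳ 0#))

  embedded-⊗ : ∀ a b → (a , 0#) ⊗ (b , 0#) ≡ (a * b , 0#)
  embedded-⊗ a b = cong₂ _,_
    (solve 3 (λ ν a b → a :* b :+ ν :* (con 0 :* con 0) := a :* b) refl ν a b)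
    (solve 2 (λ a b → a :* con 0 :+ con 0 :* b := con 0) refl a b)

  embedded-^ : ∀ a n → (a , 0#) E.^ n ≡ (a ^ n , 0#)
  embedded-^ a zero    = refl
  embedded-^ a (suc n) = trans (cong ((a , 0#) ⊗_) (embedded-^ a n)) (embedded-⊗ a (a ^ n))

  √ν : K
  √ν = 0# , 1#

  √ν^odd : ∀ h → √ν E.^ suc (h ℕ.+ h) ≡ (0# , ν ^ h)
  √ν^odd zero = cong₂ _,_
    (solve 1 (λ ν → con 0 :* con 1 :+ ν :* (con 1 :* con 0) := con 0) refl ν)
    (solve 0 (con 0 :* con 0 :+ con 1 :* con 1 := con 1) refl)
  √ν^odd (suc h) = begin
    √ν ⊗ (√ν E.^ (suc h ℕ.+ suc h))    ≡⟨ cong (λ n → √ν ⊗ (√ν ⊗ (√ν E.^ n))) (ℕ.+-suc h h) ⟩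
    √ν ⊗ (√ν ⊗ (√ν E.^ suc (h ℕ.+ h))) ≡⟨ cong (λ z → √ν ⊗ (√ν ⊗ z)) (√ν^odd h) ⟩
    √ν ⊗ (√ν ⊗ (0# , ν ^ h))           ≡⟨ cong₂ _,_
      (solve 2 (λ ν n → con 0 :* (con 0 :* con 0 :+ ν :* (con 1 :* n)) :+ ν :* (con 1 :* (con 0 :* n :+ con 1 :* con 0)) := con 0) refl ν (ν ^ h))
      (solve 2 (λ ν n → con 0 :* (con 0 :* n :+ con 1 :* con 0) :+ con 1 :* (con 0 :* con 0 :+ ν :* (con 1 :* n)) := ν :* n) refl ν (ν ^ h)) ⟩
    (0# , ν ^ suc h)                   ∎

  ν≢0 : ν ≢ 0#
  ν≢0 ν≡0 = proj₂ nonSquare 0# (trans (zeroˡ 0#) (sym ν≡0))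

  c : Carrier
  c = ν ^ half

  c*c≡1 : c * c ≡ 1#
  c*c≡1 = *-cancelˡ-nonZero ν ν≢0 (begin
    ν * (c * c)                 ≡⟨ cong (ν *_) (^-homo-* ν half half) ⟨
    ν ^ suc (half ℕ.+ half)     ≡⟨ cong (ν ^_) Q-odd ⟨
    ν ^ Q                       ≡⟨ x^Q≡x ν ⟩
    ν                           ≡⟨ *-identityʳ ν ⟨
    ν * 1#                      ∎)

  E-p⋆1≡0 : p E.⋆ E.1# ≡ E.0#
  E-p⋆1≡0 = trans (embedded⋆ p) (cong (_, 0#) p⋆1≡0)

  -- since √ν ^ Q = c √ν with c² = 1
  frobenius : ∀ a b → (a , b) E.^ Q ≡ (a , b * c)
  frobenius a b = begin
    (a , b) E.^ Q
      ≡⟨ cong (E._^ Q) decompose ⟩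
    ((a , 0#) ⊕ (b , 0#) ⊗ √ν) E.^ Q
      ≡⟨ subst (λ q → ((a , 0#) ⊕ (b , 0#) ⊗ √ν) E.^ q ≡ (a , 0#) E.^ q ⊕ ((b , 0#) ⊗ √ν) E.^ q) (sym Q≡p^D) (Frobenius.^p^n-distrib-+ extension pr E-p⋆1≡0 D (a , 0#) ((b , 0#) ⊗ √ν)) ⟩
    (a , 0#) E.^ Q ⊕ ((b , 0#) ⊗ √ν) E.^ Q
      ≡⟨ cong ((a , 0#) E.^ Q ⊕_) (E.^-distrib-* (b , 0#) √ν Q) ⟩
    (a , 0#) E.^ Q ⊕ (b , 0#) E.^ Q ⊗ √ν E.^ Q
      ≡⟨ cong₂ (λ u v → u ⊕ v ⊗ √ν E.^ Q) (embedded a) (embedded b) ⟩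
    (a , 0#) ⊕ (b , 0#) ⊗ √ν E.^ Q
      ≡⟨ cong (λ z → (a , 0#) ⊕ (b , 0#) ⊗ z) (trans (cong (√ν E.^_) Q-odd) (√ν^odd half)) ⟩
    (a , 0#) ⊕ (b , 0#) ⊗ (0# , c)
      ≡⟨ cong₂ _,_
           (solve 4 (λ ν a b c → a :+ (b :* con 0 :+ ν :* (con 0 :* c)) := a) refl ν a b c)
           (solve 2 (λ b c → con 0 :+ (b :* c :+ con 0 :* con 0) := b :* c) refl b c) ⟩
    (a , b * c) ∎
    where
    decompose : (a , b) ≡ (a , 0#) ⊕ (b , 0#) ⊗ √ν
    decompose = cong₂ _,_
      (solve 3 (λ ν a b → a := a :+ (b :* con 0 :+ ν :* (con 0 :* con 1))) refl ν a b)
      (solve 1 (λ b → b := con 0 :+ (b :* con 1 :+ con 0 :* con 0)) refl b)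
    embedded : ∀ a → (a , 0#) E.^ Q ≡ (a , 0#)
    embedded a = trans (embedded-^ a Q) (cong (_, 0#) (x^Q≡x a))

  x^QQ≡x : ∀ x → x E.^ (Q ℕ.* Q) ≡ x
  x^QQ≡x (a , b) = begin
    (a , b) E.^ (Q ℕ.* Q)       ≡⟨ E.^-assocʳ (a , b) Q Q ⟨
    ((a , b) E.^ Q) E.^ Q       ≡⟨ cong (E._^ Q) (frobenius a b) ⟩
    (a , b * c) E.^ Q           ≡⟨ frobenius a (b * c) ⟩
    (a , b * c * c)             ≡⟨ cong (a ,_) (trans (*-assoc b c c) (trans (cong (b *_) c*c≡1) (*-identityʳ b))) ⟩
    (a , b)                     ∎

  extensionField : GaloisField p (D ℕ.+ D)
  extensionField = record
    { F = extension
    ; Q = Q ℕ.* Q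
    -- From (2h + 1)² = 2(2h + 2h²) + 1.
    ; half = half ℕ.+ half ℕ.+ 2 ℕ.* (half ℕ.* half)
    ; Q≡p^D = trans (cong₂ ℕ._*_ Q≡p^D Q≡p^D) (sym (ℕ.^-distribˡ-+-* p D D))
    ; Q-odd = trans (cong₂ ℕ._*_ Q-odd Q-odd)
        (ℕs.solve 1 (λ h → (ℕs.con 1 ℕs.:+ (h ℕs.:+ h)) ℕs.:* (ℕs.con 1 ℕs.:+ (h ℕs.:+ h))
          ℕs.:= ℕs.con 1 ℕs.:+ ((h ℕs.:+ h ℕs.:+ ℕs.con 2 ℕs.:* (h ℕs.:* h)) ℕs.:+ (h ℕs.:+ h ℕs.:+ ℕs.con 2 ℕs.:* (h ℕs.:* h)))) refl half)
    ; index = λ (a , b) → combine (index a) (index b)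
    ; element = λ i → element (proj₁ (remQuot {Q} Q i)) , element (proj₂ (remQuot {Q} Q i))
    ; element-index = λ (a , b) → trans (cong (λ (i , j) → element i , element j) (Fin.remQuot-combine (index a) (index b)))
        (cong₂ _,_ (element-index a) (element-index b))
    ; index-element = λ i → trans (cong₂ combine (index-element (proj₁ (remQuot {Q} Q i))) (index-element (proj₂ (remQuot {Q} Q i)))) (Fin.combine-remQuot {Q} Q i)
    ; 1+1≢0 = 1+1≢0 ∘ ,-injectiveˡ
    ; p⋆1≡0 = E-p⋆1≡0
    ; x^Q≡x = x^QQ≡x
    ; scalar = λ i → scalar i , 0#
    ; scalar-injective = scalar-injective ∘ ,-injectiveˡ
    ; scalar^p = λ i → trans (embedded-^ (scalar i) p) (cong (_, 0#) (scalar^p i))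
    }
    where module ℕs = ℕSolver.+-*-Solver

-- Families of functions with few common values

-- Rows will be the graphs of these functions and columns the pairs of a point and a value, so an
-- all-ones s by t block amounts to `s` functions agreeing at `t` points.
record AgreementSystem (s t R A B : ℕ) : Set where
  field
    f : Fin R → Fin A → Fin B
    fewAgreements : (g : Fin s → Fin R) → (∀ {i j} → g i ≡ g j → i ≡ j) →
      (h : Fin t → Fin A) → (∀ {x y} → h x ≡ h y → x ≡ y) →
      ¬ (∀ i j x → f (g i) (h x) ≡ f (g j) (h x))

enumerate : ∀ {n} {P : Fin n → Set} → (∀ i → Dec (P i)) →
  ∃ λ R → ∃ λ (e : Fin R → Fin n) → (∀ {i j} → e i ≡ e j → i ≡ j) × (∀ i → P (e i)) × (∀ j → P j → ∃ λ i → e i ≡ j)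
enumerate {zero} P? = 0 , (λ ()) , (λ { {()} }) , (λ ()) , λ ()
enumerate {suc n} {P} P? with enumerate (P? ∘ suc) | P? zero
... | R , e , e-inj , Pe , hit | no ¬P0 = R , suc ∘ e , e-inj ∘ Fin.suc-injective , Pe , hit′
  where
  hit′ : ∀ j → P j → ∃ λ i → suc (e i) ≡ j
  hit′ zero    P0 = contradiction P0 ¬P0
  hit′ (suc j) Pj = proj₁ (hit j Pj) , cong suc (proj₂ (hit j Pj))
... | R , e , e-inj , Pe , hit | yes P0 = suc R , e′ , e′-inj , Pe′ , hit′
  where
  e′ : Fin (suc R) → Fin (suc n)
  e′ zero    = zero
  e′ (suc i) = suc (e i)
  hit′ : ∀ j → P j → ∃ λ i → e′ i ≡ j
  hit′ zero    _  = zero , refl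
  hit′ (suc j) Pj = suc (proj₁ (hit j Pj)) , cong suc (proj₂ (hit j Pj))
  e′-inj : ∀ {i j} → e′ i ≡ e′ j → i ≡ j
  e′-inj {zero}  {zero}  _  = refl
  e′-inj {suc i} {suc j} eq = cong suc (e-inj (Fin.suc-injective eq))
  Pe′ : ∀ i → P (e′ i)
  Pe′ zero    = P0
  Pe′ (suc i) = Pe i

prime≥2 : ∀ {q} → Prime q → ∃ λ n → q ≡ suc (suc n)
prime≥2 {zero}        pr = contradiction pr ¬prime[0]
prime≥2 {suc zero}    pr = contradiction pr ¬prime[1]
prime≥2 {suc (suc n)} pr = n , refl

module NormSystem {p D : ℕ} (pr : Prime p) .{{_ : ℕ.NonZero D}} (G : GaloisField p D) where
  open GaloisField G
  open FieldProperties F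
  open ≡-Reasoning

  σ^_ : ℕ → Carrier → Carrier
  (σ^ l) x = x ^ (p ℕ.^ l)

  σ^-+ : ∀ a b x → (σ^ a) ((σ^ b) x) ≡ (σ^ (b ℕ.+ a)) x
  σ^-+ a b x = trans (^-assocʳ x (p ℕ.^ b) (p ℕ.^ a)) (cong (x ^_) (sym (ℕ.^-distribˡ-+-* p b a)))

  σ^D : ∀ x → (σ^ D) x ≡ x
  σ^D x = trans (cong (x ^_) (sym Q≡p^D)) (x^Q≡x x)

  σ^[D+l] : ∀ l x → (σ^ (D ℕ.+ l)) x ≡ (σ^ l) x
  σ^[D+l] l x = trans (sym (σ^-+ l D x)) (cong (σ^ l) (σ^D x))

  σ^[f*D+l] : ∀ f l x → (σ^ (f ℕ.* D ℕ.+ l)) x ≡ (σ^ l) x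
  σ^[f*D+l] zero    l x = refl
  σ^[f*D+l] (suc f) l x = trans (cong (λ n → (σ^ n) x) (ℕ.+-assoc D (f ℕ.* D) l)) (trans (σ^[D+l] _ x) (σ^[f*D+l] f l x))

  σ^% : ∀ n x → (σ^ n) x ≡ (σ^ (n % D)) x
  σ^% n x = trans (cong (λ m → (σ^ m) x) (trans (m≡m%n+[m/n]*n n D) (ℕ.+-comm (n % D) _))) (σ^[f*D+l] (n / D) (n % D) x)

  σ^0 : ∀ x → (σ^ 0) x ≡ x
  σ^0 = *-identityʳ

  -- The D-th power of `σ^ a` is the identity, so its inverse is its power D - 1.
  inverse-σ^ : ∀ a {x y} → (σ^ a) x ≡ y → x ≡ (σ^ (a ℕ.* ℕ.pred D)) y
  inverse-σ^ a {x} {y} eq = begin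
    x                                        ≡⟨ σ^0 x ⟨
    (σ^ 0) x                                 ≡⟨ σ^[f*D+l] a 0 x ⟨
    (σ^ (a ℕ.* D ℕ.+ 0)) x                   ≡⟨ cong (λ n → (σ^ n) x) (trans (ℕ.+-identityʳ _) a*D≡) ⟩
    (σ^ (a ℕ.+ a ℕ.* ℕ.pred D)) x            ≡⟨ σ^-+ (a ℕ.* ℕ.pred D) a x ⟨
    (σ^ (a ℕ.* ℕ.pred D)) ((σ^ a) x)         ≡⟨ cong (σ^ (a ℕ.* ℕ.pred D)) eq ⟩
    (σ^ (a ℕ.* ℕ.pred D)) y                  ∎
    where
    a*D≡ : a ℕ.* D ≡ a ℕ.+ a ℕ.* ℕ.pred D
    a*D≡ = trans (cong (a ℕ.*_) (sym (ℕ.suc-pred D))) (ℕ.*-suc a (ℕ.pred D))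

  DistinctOrbits : ∀ {R} → (Fin R → Carrier) → Set
  DistinctOrbits θ = ∀ {i j} a b → (σ^ a) (θ i) ≡ (σ^ b) (θ j) → i ≡ j

  -- The representative of an orbit is its element of least index. Every element is `σ^ n` of a
  -- representative with n < D, so there are at least Q / D orbits.
  orbitRepresentatives : ∃ λ R → ∃ λ (θ : Fin R → Carrier) → DistinctOrbits θ × Q ℕ.≤ R ℕ.* D
  orbitRepresentatives with enumerate (λ j → Fin.all? (λ (a : Fin D) → toℕ j ℕ.≤? toℕ (index ((σ^ toℕ a) (element j)))))
  ... | R , e , e-inj , minimal , hit = R , θ , distinct , Fin.injective⇒≤ {f = locate} locate-injective
    where
    θ : Fin R → Carrier
    θ = element ∘ e
    σ^mod : ∀ n x → (σ^ toℕ (n mod D)) x ≡ (σ^ n) x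
    σ^mod n x = trans (cong (λ m → (σ^ m) x) (Fin.toℕ-fromℕ< (m%n<n n D))) (sym (σ^% n x))
    ≤orbit : ∀ i j n → θ j ≡ (σ^ n) (θ i) → toℕ (e i) ℕ.≤ toℕ (e j)
    ≤orbit i j n eq = subst (λ z → toℕ (e i) ℕ.≤ toℕ z)
      (trans (cong index (trans (σ^mod n (θ i)) (sym eq))) (index-element (e j))) (minimal i (n mod D))
    distinct : DistinctOrbits θ
    distinct {i} {j} a b eq = e-inj (Fin.toℕ-injective (ℕ.≤-antisym
      (≤orbit i j (a ℕ.+ b ℕ.* ℕ.pred D) (trans (inverse-σ^ b (sym eq)) (σ^-+ (b ℕ.* ℕ.pred D) a (θ i))))
      (≤orbit j i (b ℕ.+ a ℕ.* ℕ.pred D) (trans (inverse-σ^ a eq) (σ^-+ (a ℕ.* ℕ.pred D) b (θ j))))))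
    -- Moving to a conjugate of smaller index terminates, and an element with no such conjugate is a
    -- representative.
    descend : ∀ j → Acc ℕ._<_ (toℕ j) → ∃ λ i → ∃ λ n → (σ^ n) (θ i) ≡ element j
    descend j (acc smaller) with Fin.any? (λ (a : Fin D) → toℕ (index ((σ^ toℕ a) (element j))) ℕ.<? toℕ j)
    ... | no none = proj₁ found , 0 , trans (σ^0 _) (cong element (proj₂ found))
      where found = hit j λ a → ℕ.≮⇒≥ λ lt → none (a , lt)
    ... | yes (a , lt) with descend (index ((σ^ toℕ a) (element j))) (smaller lt)
    ...   | i , n , eq = i , n ℕ.+ toℕ a ℕ.* ℕ.pred D , trans (sym (σ^-+ (toℕ a ℕ.* ℕ.pred D) n (θ i))) (sym (inverse-σ^ (toℕ a) (trans (sym (element-index _)) (sym eq))))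
    represent : ∀ j → ∃ λ i → ∃ λ n → (σ^ n) (θ i) ≡ element j
    represent j = descend j (<-wellFounded (toℕ j))
    locate : Fin Q → Fin (R ℕ.* D)
    locate j = combine (proj₁ (represent j)) (proj₁ (proj₂ (represent j)) mod D)
    locate-injective : ∀ {j k} → locate j ≡ locate k → j ≡ k
    locate-injective {j} {k} eq with represent j | represent k
    ... | i , n , eqj | i′ , n′ , eqk = begin
      j                                       ≡⟨ index-element j ⟨
      index (element j)                       ≡⟨ cong index (trans (sym eqj) (sym (σ^mod n (θ i)))) ⟩
      index ((σ^ toℕ (n mod D)) (θ i))        ≡⟨ cong₂ (λ i m → index ((σ^ toℕ m) (θ i))) (proj₁ same) (proj₂ same) ⟩
      index ((σ^ toℕ (n′ mod D)) (θ i′))      ≡⟨ cong index (trans (σ^mod n′ (θ i′)) eqk) ⟩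
      index (element k)                       ≡⟨ index-element k ⟩
      k                                       ∎
      where
      same : i ≡ i′ × n mod D ≡ n′ mod D
      same = Fin.combine-injective i (n mod D) i′ (n′ mod D) eq

  top : ∀ q → Fin (suc q) → Carrier
  top zero    _       = 1#
  top (suc q) zero    = 0#
  top (suc q) (suc i) = top q i

  eval-top : ∀ q x → eval (top q) x ≡ x ^ q
  eval-top zero    x = trans (cong (1# +_) (zeroʳ x)) (+-identityʳ 1#)
  eval-top (suc q) x = trans (+-identityˡ _) (cong (x *_) (eval-top q x))

  top-last : ∀ q → top q (fromℕ q) ≡ 1#
  top-last zero    = refl
  top-last (suc q) = top-last q

  -- X^p - X already has the p scalars as roots; one more would give p + 1 roots and force its
  -- leading coefficient 1 to vanish.
  x^p≡x⇒scalar : ∀ w → w ^ p ≡ w → ∃ λ j → scalar j ≡ w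
  x^p≡x⇒scalar w w^p≡w with Fin.any? (λ j → scalar j ≟ w)
  ... | yes hit = hit
  ... | no none = contradiction (leading≡0 (proj₁ (prime≥2 pr)) (proj₂ (prime≥2 pr))) 1≢0
    where
    ξ : Fin (suc p) → Carrier
    ξ zero    = w
    ξ (suc j) = scalar j
    distinct : Distinct ξ
    distinct {zero}  {zero}  _  = refl
    distinct {zero}  {suc j} eq = contradiction (j , sym eq) none
    distinct {suc i} {zero}  eq = contradiction (i , eq) none
    distinct {suc i} {suc j} eq = cong suc (scalar-injective eq)
    fixed : ∀ i → ξ i ^ p ≡ ξ i
    fixed zero    = w^p≡w
    fixed (suc j) = scalar^p j
    -- Writing p = p′ + 2 exposes the two lowest coefficients 0 and -1 of X^p - X, followed by those
    -- of X^p′.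
    leading≡0 : ∀ p′ → p ≡ suc (suc p′) → 1# ≡ 0#
    leading≡0 p′ p≡ = trans (sym (top-last p′)) (manyRoots⇒zero (ξ ∘ resize) resize-distinct X^p-X root (suc (suc (fromℕ p′))))
      where
      resize : Fin (suc (suc (suc p′))) → Fin (suc p)
      resize = cast (cong suc (sym p≡))
      resize-distinct : Distinct (ξ ∘ resize)
      resize-distinct {i} {j} eq = Fin.toℕ-injective (trans (sym (Fin.toℕ-cast _ i)) (trans (cong toℕ (distinct {resize i} {resize j} eq)) (Fin.toℕ-cast _ j)))
      X^p-X : Fin (suc (suc (suc p′))) → Carrier
      X^p-X zero          = 0#
      X^p-X (suc zero)    = - 1#
      X^p-X (suc (suc i)) = top p′ i
      root : ∀ i → eval X^p-X (ξ (resize i)) ≡ 0#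
      root i = begin
        0# + x * (- 1# + x * eval (top p′) x)   ≡⟨ +-identityˡ _ ⟩
        x * (- 1# + x * eval (top p′) x)        ≡⟨ cong (λ z → x * (- 1# + x * z)) (eval-top p′ x) ⟩
        x * (- 1# + x ^ suc p′)                 ≡⟨ distribˡ x (- 1#) (x ^ suc p′) ⟩
        x * - 1# + x ^ suc (suc p′)             ≡⟨ cong (λ q → x * - 1# + x ^ q) p≡ ⟨
        x * - 1# + x ^ p                        ≡⟨ cong (x * - 1# +_) (trans (fixed (resize i)) (sym (*-identityʳ x))) ⟩
        x * - 1# + x * 1#                       ≡⟨ distribˡ x (- 1#) 1# ⟨
        x * (- 1# + 1#)                         ≡⟨ cong (x *_) (-‿inverseˡ 1#) ⟩
        x * 0#                                  ≡⟨ zeroʳ x ⟩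
        0#                                      ∎
        where x = ξ (resize i)

  ∏<-shift : ∀ n a → ∏< (suc n) a ≡ a 0 * ∏< n (a ∘ suc)
  ∏<-shift zero    a = refl
  ∏<-shift (suc n) a = begin
    a (suc n) * ∏< (suc n) a                    ≡⟨ cong (a (suc n) *_) (∏<-shift n a) ⟩
    a (suc n) * (a 0 * ∏< n (a ∘ suc))          ≡⟨ *-assoc _ _ _ ⟨
    a (suc n) * a 0 * ∏< n (a ∘ suc)            ≡⟨ cong (_* ∏< n (a ∘ suc)) (*-comm _ _) ⟩
    a 0 * a (suc n) * ∏< n (a ∘ suc)            ≡⟨ *-assoc _ _ _ ⟩
    a 0 * ∏< (suc n) (a ∘ suc)                  ∎

  ∏<-^p : ∀ n (a : ℕ → Carrier) → (∀ l → a l ^ p ≡ a (suc l)) → ∏< n a ^ p ≡ ∏< n (a ∘ suc)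
  ∏<-^p zero    a _    = 1^n≡1 p
  ∏<-^p (suc n) a step = trans (^-distrib-* (a n) (∏< n a) p) (cong₂ _*_ (step n) (∏<-^p n a step))

  -- Frobenius permutes the D conjugate factors cyclically.
  norm-fixed : ∀ (a : ℕ → Carrier) → (∀ l → a l ^ p ≡ a (suc l)) → a D ≡ a 0 → ∏< D a ^ p ≡ ∏< D a
  norm-fixed a step aD≡a0 = trans (∏<-^p D a step) (rotate D aD≡a0)
    where
    rotate : ∀ n → a n ≡ a 0 → ∏< n (a ∘ suc) ≡ ∏< n a
    rotate zero    _  = refl
    rotate (suc n) eq = trans (cong (_* ∏< n (a ∘ suc)) eq) (sym (∏<-shift n a))

  module _ (k : ℕ) where

    -- x encodes the polynomial 1 + x₁T + ⋯ + x_kT^k over the prime field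
    coefficient : Fin (p ℕ.^ k) → Fin (suc k) → Carrier
    coefficient x zero    = 1#
    coefficient x (suc i) = scalar (finToFun {p} {k} x i)

    value : Carrier → ℕ → Fin (p ℕ.^ k) → Carrier
    value θ l x = eval (coefficient x) ((σ^ l) θ)

    normValue : Carrier → Fin (p ℕ.^ k) → Carrier
    normValue θ x = ∏< D (λ l → value θ l x)

    coefficient^p : ∀ x i → coefficient x i ^ p ≡ coefficient x i
    coefficient^p x zero    = 1^n≡1 p
    coefficient^p x (suc i) = scalar^p _

    eval^p : ∀ {n} (c : Fin n → Carrier) → (∀ i → c i ^ p ≡ c i) → ∀ x → eval c x ^ p ≡ eval c (x ^ p)
    eval^p {zero} c _ x with prime≥2 pr
    ... | p′ , p≡ = trans (cong (0# ^_) p≡) (zeroˡ _)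
    eval^p {suc n} c c^p≡c x = begin
      (c zero + x * eval (c ∘ suc) x) ^ p          ≡⟨ Frobenius.^p-distrib-+ F pr p⋆1≡0 _ _ ⟩
      c zero ^ p + (x * eval (c ∘ suc) x) ^ p      ≡⟨ cong₂ _+_ (c^p≡c zero) (^-distrib-* x _ p) ⟩
      c zero + x ^ p * eval (c ∘ suc) x ^ p        ≡⟨ cong (λ z → c zero + x ^ p * z) (eval^p (c ∘ suc) (c^p≡c ∘ suc) x) ⟩
      c zero + x ^ p * eval (c ∘ suc) (x ^ p)      ∎

    normValue^p : ∀ θ x → normValue θ x ^ p ≡ normValue θ x
    normValue^p θ x = norm-fixed (λ l → value θ l x) step (cong (eval (coefficient x)) (trans (σ^D θ) (sym (σ^0 θ))))
      where
      step : ∀ l → value θ l x ^ p ≡ value θ (suc l) x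
      step l = trans (eval^p (coefficient x) (coefficient^p x) _)
        (cong (eval (coefficient x)) (trans (^-assocʳ θ (p ℕ.^ l) p) (cong (θ ^_) (ℕ.*-comm (p ℕ.^ l) p))))

    module _ {R r} (θ : Fin R → Carrier) (θ-distinct : DistinctOrbits θ)
      (g : Fin (suc k) → Fin R) (g-inj : ∀ {i j} → g i ≡ g j → i ≡ j)
      (h : Fin r → Fin (p ℕ.^ k)) (h-inj : ∀ {x y} → h x ≡ h y → x ≡ y) where

      -- Constant term 1 makes distinct polynomials non-proportional, hence separable by a linear
      -- form: if they differ in the coefficient of T^j, take c_j - a c_0, where a is that
      -- coefficient of the polynomial at `w`. For `z = w` the form c_0 has value 1.
      separator : ∀ z w → ∃ λ (β : Fin (suc k) → Carrier) →
        (w ≢ z → β · coefficient (h w) ≡ 0#) × β · coefficient (h z) ≢ 0#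
      separator z w with z Fin.≟ w | Fin.any? (λ i → ¬? (finToFun {p} {k} (h z) i Fin.≟ finToFun (h w) i))
      ... | yes refl | _ = δ zero , (λ w≢w → contradiction refl w≢w) , λ eq → 1≢0 (trans (sym (δ-· zero (coefficient (h z)))) eq)
      ... | no z≢w | no same = contradiction
        (h-inj (finToFun-injective {k} {p} (h z) (h w) λ i → decide i)) z≢w
        where
        decide : ∀ i → finToFun (h z) i ≡ finToFun (h w) i
        decide i with finToFun {p} {k} (h z) i Fin.≟ finToFun (h w) i
        ... | yes eq = eq
        ... | no neq = contradiction (i , neq) same
      ... | no _ | yes (i , differ) = β , (λ _ → trans (β-· w) (-‿inverseˡ _))
          , λ eq → y-x≢0 (λ eq′ → differ (scalar-injective (sym eq′))) (trans (+-comm _ _) (trans (sym (β-· z)) eq))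
        where
        c = scalar (finToFun {p} {k} (h w) i)
        β : Fin (suc k) → Carrier
        β zero    = - c
        β (suc j) = δ i j
        β-· : ∀ x → β · coefficient (h x) ≡ - c + scalar (finToFun (h x) i)
        β-· x = cong₂ _+_ (*-identityʳ (- c)) (δ-· i (λ j → scalar (finToFun (h x) j)))

      -- The forms are the values of χ at conjugates of the `θ (g i)`. As the orbits are distinct,
      -- one conjugate from each row always gives `suc k` distinct nodes, whatever the exponents, so
      -- interpolation supplies the spanning hypothesis.
      agreement-bound : (∀ i x → normValue (θ (g (suc i))) (h x) ≡ normValue (θ (g zero)) (h x)) → r ℕ.≤ D ℕ.^ k
      agreement-bound = Bézout.points≤D^k F index element element-index index-element k D r
        (λ i l x → value (θ (g i)) l (h x))
        (λ i l x → cong (eval (coefficient (h x))) (σ^[D+l] l (θ (g i))))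
        (λ z w x → proj₁ (separator z w) · coefficient (h x))
        (λ {z} {w} → proj₁ (proj₂ (separator z w)))
        (λ z w → proj₂ (proj₂ (separator z w)))
        (λ e z w → let α , spec = interpolation (λ i → (σ^ e i) (θ (g i))) (λ {i} {j} eq → g-inj (θ-distinct (e i) (e j) eq)) (proj₁ (separator z w))
                   in α , λ x → spec (coefficient (h x)))

    normSystem : ∃ λ R → Q ℕ.≤ R ℕ.* D × (∀ {t} → D ℕ.^ k ℕ.< t → AgreementSystem (suc k) t R (p ℕ.^ k) p)
    normSystem with orbitRepresentatives
    ... | R , θ , θ-distinct , Q≤ = R , Q≤ , λ D^k<t → record
      { f = λ i x → code (θ i) x
      ; fewAgreements = λ g g-inj h h-inj agree → ℕ.<⇒≱ D^k<t (agreement-bound θ θ-distinct g g-inj h h-inj λ i x →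
          trans (sym (scalar-code (θ (g (suc i))) (h x))) (trans (cong scalar (agree (suc i) zero x)) (scalar-code (θ (g zero)) (h x))))
      }
      where
      code : Carrier → Fin (p ℕ.^ k) → Fin p
      code θ x = proj₁ (x^p≡x⇒scalar (normValue θ x) (normValue^p θ x))
      scalar-code : ∀ θ x → scalar (code θ x) ≡ normValue θ x
      scalar-code θ x = proj₂ (x^p≡x⇒scalar (normValue θ x) (normValue^p θ x))

-- From families of functions to matrices

open import Data.Nat hiding (zero; suc)
open import Data.Nat.Properties
open import Data.Nat.ListAction using (sum)
open import Data.Bool using (true; false; if_then_else_)
open import Data.Fin.Subset using (Subset; _∈_; ∣_∣)
open import Data.List.Base using (map; allFin; tabulate)
open import Data.List.Properties using (map-tabulate)
open import Data.Vec.Base using ([]; _∷_; here; there)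
open ℕSolver.+-*-Solver using (solve; _:*_; _:+_; _:=_; con)

subset-injection : ∀ {n} (S : Subset n) → ∃ λ (g : Fin ∣ S ∣ → Fin n) → (∀ {i j} → g i ≡ g j → i ≡ j) × (∀ i → g i ∈ S)
subset-injection [] = (λ ()) , (λ { {()} }) , λ ()
subset-injection (false ∷ S) with subset-injection S
... | g , g-inj , g∈S = suc ∘ g , g-inj ∘ Fin.suc-injective , there ∘ g∈S
subset-injection {suc n} (true ∷ S) with subset-injection S
... | g , g-inj , g∈S = g′ , g′-inj , g′∈S
  where
  g′ : Fin (suc ∣ S ∣) → Fin (suc n)
  g′ zero    = zero
  g′ (suc i) = suc (g i)
  g′-inj : ∀ {i j} → g′ i ≡ g′ j → i ≡ j
  g′-inj {zero}  {zero}  _  = refl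
  g′-inj {suc i} {suc j} eq = cong suc (g-inj (Fin.suc-injective eq))
  g′∈S : ∀ i → g′ i ∈ true ∷ S
  g′∈S zero    = here
  g′∈S (suc i) = there (g∈S i)

sum-tabulate-injection : ∀ {a n} c (F : Fin n → ℕ) (h : Fin a → Fin n) → (∀ {x y} → h x ≡ h y → x ≡ y) →
  (∀ x → c ≤ F (h x)) → a * c ≤ sum (tabulate F)
sum-tabulate-injection {zero} c F h _ _ = z≤n
sum-tabulate-injection {suc a} {zero} c F h _ _ = contradiction (h zero) λ ()
sum-tabulate-injection {suc a} {suc n} c F h h-inj c≤ with Fin.any? (λ x → h x Fin.≟ zero)
... | yes (x₀ , hx₀≡0) = +-mono-≤ (subst (λ z → c ≤ F z) hx₀≡0 (c≤ x₀))
  (sum-tabulate-injection c (F ∘ suc) (λ x → punchOut (0≢ x))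
    (λ {x} {y} eq → Fin.punchIn-injective x₀ x y (h-inj (Fin.punchOut-injective (0≢ x) (0≢ y) eq)))
    (λ x → subst (λ z → c ≤ F z) (sym (Fin.punchIn-punchOut (0≢ x))) (c≤ (punchIn x₀ x))))
  where
  0≢ : ∀ x → zero ≢ h (punchIn x₀ x)
  0≢ x 0≡ = Fin.punchInᵢ≢i x₀ x (h-inj (trans (sym 0≡) (sym hx₀≡0)))
... | no none = ≤-trans
  (sum-tabulate-injection c (F ∘ suc) (λ x → punchOut (0≢ x))
    (λ {x} {y} eq → h-inj (Fin.punchOut-injective (0≢ x) (0≢ y) eq))
    (λ x → subst (λ z → c ≤ F z) (sym (Fin.punchIn-punchOut (0≢ x))) (c≤ x)))
  (m≤n+m _ (F zero))
  where
  0≢ : ∀ x → zero ≢ h x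
  0≢ x 0≡ = none (x , sym 0≡)

sum-allFin-injection : ∀ {a n} c (F : Fin n → ℕ) (h : Fin a → Fin n) → (∀ {x y} → h x ≡ h y → x ≡ y) →
  (∀ x → c ≤ F (h x)) → a * c ≤ sum (map F (allFin n))
sum-allFin-injection c F h h-inj c≤ = subst (_ ≤_) (cong sum (sym (map-tabulate id F))) (sum-tabulate-injection c F h h-inj c≤)

ones-injection : ∀ {a b m n} (M : Matrix m n) (g : Fin a → Fin m) (h : Fin a → Fin b → Fin n) →
  (∀ {i j} → g i ≡ g j → i ≡ j) → (∀ i {x y} → h i x ≡ h i y → x ≡ y) →
  (∀ i x → M (g i) (h i x) ≡ true) → a * b ≤ ones M
ones-injection {b = b} M g h g-inj h-inj Mgh≡true = sum-allFin-injection b _ g g-inj λ i →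
  subst (_≤ _) (*-identityʳ b) (sum-allFin-injection 1 _ (h i) (h-inj i) λ x →
    ≤-reflexive (cong (λ z → if z then 1 else 0) (sym (Mgh≡true i x))))

-- Row r is the graph of `f r`, a column being the code of a point and a value. Indices are compared
-- as numbers, so surplus rows and columns are zero. In a block of ones a column fixes both its
-- point and the common value, so distinct columns have distinct points.
agreementMatrix : ∀ {s t R A B} → AgreementSystem (suc s) (suc t) R A B → ∀ m n → A * B ≤ n →
  Σ (Matrix m n) λ M → KstFree (suc s) (suc t) M × (m ⊓ R) * A ≤ ones M
agreementMatrix {s} {t} {R} {A} {B} system m n AB≤n = M , free , many
  where
  open AgreementSystem system

  Entry : Fin m → Fin n → Set
  Entry i j = ∃ λ (r : Fin R) → ∃ λ (x : Fin A) → toℕ i ≡ toℕ r × toℕ j ≡ toℕ (combine x (f r x))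

  entry? : ∀ i j → Dec (Entry i j)
  entry? i j = Fin.any? λ r → Fin.any? λ x → (toℕ i ≟ toℕ r) ×-dec (toℕ j ≟ toℕ (combine x (f r x)))

  M : Matrix m n
  M i j = does (entry? i j)

  entry : ∀ i j → M i j ≡ true → Entry i j
  entry i j eq with entry? i j
  ... | yes e = e

  free : KstFree (suc s) (suc t) M
  free S T ∣S∣≡s ∣T∣≡t all with ∣ S ∣ | subset-injection S | ∣S∣≡s | ∣ T ∣ | subset-injection T | ∣T∣≡t
  ... | _ | g , g-inj , g∈S | refl | _ | h , h-inj , h∈T | refl = fewAgreements row row-inj col col-inj agree
    where
    e : ∀ i j → Entry (g i) (h j)
    e i j = entry (g i) (h j) (all (g i) (h j) (g∈S i) (h∈T j))
    row : Fin (suc s) → Fin R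
    row i = proj₁ (e i zero)
    row-unique : ∀ i j → proj₁ (e i j) ≡ row i
    row-unique i j = Fin.toℕ-injective (trans (sym (proj₁ (proj₂ (proj₂ (e i j))))) (proj₁ (proj₂ (proj₂ (e i zero)))))
    row-inj : ∀ {i j} → row i ≡ row j → i ≡ j
    row-inj {i} {j} eq = g-inj (Fin.toℕ-injective (trans (proj₁ (proj₂ (proj₂ (e i zero)))) (trans (cong toℕ eq) (sym (proj₁ (proj₂ (proj₂ (e j zero))))))))
    col : Fin (suc t) → Fin A
    col j = proj₁ (proj₂ (e zero j))
    column : ∀ i j → toℕ (h j) ≡ toℕ (combine (proj₁ (proj₂ (e i j))) (f (row i) (proj₁ (proj₂ (e i j)))))
    column i j = trans (proj₂ (proj₂ (proj₂ (e i j)))) (cong (λ r → toℕ (combine (proj₁ (proj₂ (e i j))) (f r (proj₁ (proj₂ (e i j)))))) (row-unique i j))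
    col-inj : ∀ {x y} → col x ≡ col y → x ≡ y
    col-inj {x} {y} eq = h-inj (Fin.toℕ-injective (trans (column zero x) (trans (cong (λ z → toℕ (combine z (f (row zero) z))) eq) (sym (column zero y)))))
    same : ∀ i j → proj₁ (proj₂ (e i j)) ≡ col j × f (row i) (proj₁ (proj₂ (e i j))) ≡ f (row zero) (col j)
    same i j = Fin.combine-injective _ _ _ _ (Fin.toℕ-injective (trans (sym (column i j)) (column zero j)))
    value : ∀ i j → f (row i) (col j) ≡ f (row zero) (col j)
    value i j = trans (cong (f (row i)) (sym (proj₁ (same i j)))) (proj₂ (same i j))
    agree : ∀ i j x → f (row i) (col x) ≡ f (row j) (col x)
    agree i j x = trans (value i x) (sym (value j x))

  many : (m ⊓ R) * A ≤ ones M
  many = ones-injection M (λ i → inject≤ i (m⊓n≤m m R)) (λ i x → inject≤ (combine x (f (inject≤ i (m⊓n≤n m R)) x)) AB≤n)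
    (λ {i} {j} → Fin.inject≤-injective _ _ i j)
    (λ i {x} {y} eq → proj₁ (Fin.combine-injective x _ y _ (Fin.inject≤-injective AB≤n AB≤n _ _ eq)))
    (λ i x → dec-true (entry? _ _) (inject≤ i (m⊓n≤n m R) , x , trans (Fin.toℕ-inject≤ i _) (sym (Fin.toℕ-inject≤ i _)) , Fin.toℕ-inject≤ _ AB≤n))

-- Choice of parameters and constants

-- It provides the degree bound d for t, the power of 2 below d, and the power of 4 below n^(1/s).
straddle : ∀ (φ : ℕ → ℕ) → (∀ h → φ h < φ (suc h)) → ∀ n → φ 0 ≤ n → ∃ λ h → φ h ≤ n × n < φ (suc h)
straddle φ φ-mono zero φ0≤0 = 0 , φ0≤0 , ≤-<-trans z≤n (φ-mono 0)
straddle φ φ-mono (suc n) φ0≤ with φ 0 ≤? n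
... | no φ0≰n = 0 , φ0≤ , subst (_< φ 1) (≤-antisym φ0≤ (≰⇒> φ0≰n)) (φ-mono 0)
... | yes φ0≤n with straddle φ φ-mono n φ0≤n
...   | h , φh≤n , n<φ with suc n <? φ (suc h)
...     | yes 1+n<φ = h , m≤n⇒m≤1+n φh≤n , 1+n<φ
...     | no 1+n≮φ = suc h , ≮⇒≥ 1+n≮φ , ≤-<-trans n<φ (φ-mono (suc h))

^-cancelˡ-≤ : ∀ k .{{_ : NonZero k}} {a b} → a ^ k ≤ b ^ k → a ≤ b
^-cancelˡ-≤ k {a} {b} a^k≤b^k = ≮⇒≥ λ b<a → <⇒≱ (^-monoˡ-< k b<a) a^k≤b^k

^-distribʳ-* : ∀ k a b → (a * b) ^ k ≡ a ^ k * b ^ k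
^-distribʳ-* zero a b = refl
^-distribʳ-* (suc k) a b = trans (cong (a * b *_) (^-distribʳ-* k a b))
  (solve 4 (λ a b u v → a :* b :* (u :* v) := a :* u :* (b :* v)) refl a b (a ^ k) (b ^ k))

^-swap : ∀ a m n → (a ^ m) ^ n ≡ (a ^ n) ^ m
^-swap a m n = trans (^-*-assoc a m n) (trans (cong (a ^_) (*-comm m n)) (sym (^-*-assoc a n m)))

m≤m^n : ∀ m n .{{_ : NonZero n}} → m ≤ m ^ n
m≤m^n zero n = z≤n
m≤m^n (suc m) (suc n) = m≤m*n (suc m) (suc m ^ n) {{m^n≢0 (suc m) n}}

n<2^n : ∀ n → n < 2 ^ n
n<2^n zero = s≤s z≤n
n<2^n (suc n) = +-mono-≤ (m^n>0 2 n) (≤-trans (n<2^n n) (m≤m+n (2 ^ n) 0))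

-- The exponents ((d+1)n + 1) / (s(s−1)n) exceed (d+1) / (s(s−1)) by so little that only a factor 2 is lost.
belowExp⇒ : ∀ k d t m n → t ≤ suc d ^ suc k → 1 ≤ n → BelowExp (suc (suc k)) t m n →
  m ^ (suc (suc k) * suc k) ≤ 2 * n ^ suc d
belowExp⇒ k d t m n t≤ 1≤n below = ≮⇒≥ λ 2N<M → <⇒≱ (begin-strict
  n * N ^ n          <⟨ *-monoˡ-< (N ^ n) {{m^n≢0 N n {{>-nonZero 1≤N}}}} (n<2^n n) ⟩
  2 ^ n * N ^ n      ≡⟨ ^-distribʳ-* n 2 N ⟨
  (2 * N) ^ n        ≤⟨ ^-monoˡ-≤ n (<⇒≤ 2N<M) ⟩
  M ^ n              ∎) M^n≤
  where
  open ≤-Reasoning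
  w : ℕ
  w = suc (suc k) * suc k
  M = m ^ w
  N = n ^ suc d
  instance
    n≢0 : NonZero n
    n≢0 = >-nonZero 1≤n
  1≤N : 1 ≤ N
  1≤N = m^n>0 n (suc d)
  exponent-large : t * (w * n) ^ suc k < ((suc d * n + 1) * w) ^ suc k
  exponent-large = begin-strict
    t * (w * n) ^ suc k                   ≤⟨ *-monoˡ-≤ ((w * n) ^ suc k) t≤ ⟩
    suc d ^ suc k * (w * n) ^ suc k       ≡⟨ ^-distribʳ-* (suc k) (suc d) (w * n) ⟨
    (suc d * (w * n)) ^ suc k             <⟨ ^-monoˡ-< (suc k) (begin-strict
      suc d * (w * n)                       <⟨ m<m+n _ {w} (s≤s z≤n) ⟩
      suc d * (w * n) + w                   ≡⟨ solve 3 (λ e w n → e :* (w :* n) :+ w := (e :* n :+ con 1) :* w) refl (suc d) w n ⟩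
      (suc d * n + 1) * w                   ∎) ⟩
    ((suc d * n + 1) * w) ^ suc k         ∎
  M^n≤ : M ^ n ≤ n * N ^ n
  M^n≤ = begin
    (m ^ w) ^ n            ≡⟨ ^-*-assoc m w n ⟩
    m ^ (w * n)            ≤⟨ below (suc d * n + 1) (w * n) (*-mono-≤ {1} {w} (s≤s z≤n) 1≤n) exponent-large ⟩
    n ^ (suc d * n + 1)    ≡⟨ cong (n ^_) (+-comm (suc d * n) 1) ⟩
    n * n ^ (suc d * n)    ≡⟨ cong (n *_) (^-*-assoc n (suc d) n) ⟨
    n * N ^ n              ∎

-- Two polynomials of degree below `t` agreeing at `t` points are equal, because each coefficient is
-- a combination of the values there.
polynomialSystem : ∀ {p} t → Prime p → 3 ≤ p → AgreementSystem 2 t (p ^ t) p p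
polynomialSystem {suc p-1} t pr 3≤p = record
  { f = λ u x → eval (finToFun {p} {t} u) x
  ; fewAgreements = λ g g-inj h h-inj agree → contradiction
      (g-inj {zero} {suc zero} (finToFun-injective {t} {p} _ _ λ i → coefficients-equal g h h-inj agree i)) λ ()
  }
  where
  open PrimeField p-1 pr 3≤p
  open FieldProperties field′ using (eval; interpolation; δ; δ-·; sum-cong-≗; _·_) renaming (_*_ to _⊠_)
  coefficients-equal : ∀ (g : Fin 2 → Fin (p ^ t)) (h : Fin t → Fin p) (h-inj : ∀ {x y} → h x ≡ h y → x ≡ y) →
    (∀ i j x → eval (finToFun {p} {t} (g i)) (h x) ≡ eval (finToFun {p} {t} (g j)) (h x)) →
    ∀ i → finToFun {p} {t} (g zero) i ≡ finToFun (g (suc zero)) i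
  coefficients-equal g h h-inj agree i with interpolation h h-inj (δ i)
  ... | α , spec = begin
    u i                                ≡⟨ δ-· i u ⟨
    δ i · u                            ≡⟨ spec u ⟩
    α · (λ j → eval u (h j))           ≡⟨ sum-cong-≗ (λ j → cong (α j ⊠_) (agree zero (suc zero) j)) ⟩
    α · (λ j → eval v (h j))           ≡⟨ spec v ⟨
    δ i · v                            ≡⟨ δ-· i v ⟩
    v i                                ∎
    where
    open ≡-Reasoning
    u = finToFun {p} {t} (g zero)
    v = finToFun {p} {t} (g (suc zero))

galoisField2^ : ∀ {p} → Prime p → 3 ≤ p → ∀ e → GaloisField p (2 ^ e)
galoisField2^ {suc p-1} pr 3≤p zero = PrimeField.galoisField p-1 pr 3≤p
galoisField2^ {p} pr 3≤p (suc e) = subst (GaloisField p) (cong (2 ^ e +_) (sym (+-identityʳ (2 ^ e))))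
  (QuadraticExtension.extensionField pr (galoisField2^ pr 3≤p e))

-- Here s = k + 2, so the exponent s - 1 is `suc k`. The last inequality says that R is at least
-- p^((d+1)/(s-1)) / e, with `e` independent of p.
PrimeSystems : ℕ → ℕ → ℕ → ℕ → Set
PrimeSystems k t d e = ∀ {p} → Prime p → 3 ≤ p →
  ∃ λ R → AgreementSystem (suc (suc k)) t R (p ^ suc k) p × p ^ suc d ≤ (e * R) ^ suc k

manyFunctions : ∀ k t d → 1 ≤ d → d ^ suc k < t → t ≤ suc d ^ suc k →
  ∃ λ e → 1 ≤ e × PrimeSystems k t d e
manyFunctions zero t d 1≤d d<t t≤ = 1 , s≤s z≤n , λ {p} pr 3≤p →
  p ^ t , subst (λ a → AgreementSystem 2 t (p ^ t) a p) (sym (^-identityʳ p)) (polynomialSystem t pr 3≤p)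
  , ≤-reflexive (begin
      -- For s = 2 the bounds d < t ≤ d + 1 leave only t = d + 1.
      p ^ suc d               ≡⟨ cong (p ^_) (≤-antisym (subst (_< t) (^-identityʳ d) d<t) (subst (t ≤_) (^-identityʳ (suc d)) t≤)) ⟩
      p ^ t                   ≡⟨ *-identityˡ _ ⟨
      1 * p ^ t               ≡⟨ ^-identityʳ _ ⟨
      (1 * p ^ t) ^ 1         ∎)
  where open ≡-Reasoning
manyFunctions (suc k) t d 1≤d d^k<t t≤ with straddle (2 ^_) (λ h → ^-monoʳ-< 2 (s≤s (s≤s z≤n)) (n<1+n h)) d 1≤d
... | e , 2^e≤d , d<2^e+1 = 2 ^ e , m^n>0 2 e , functions
  where
  instance
    2^e≢0 : NonZero (2 ^ e)
    2^e≢0 = m^n≢0 2 e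
  module _ {p} (pr : Prime p) (3≤p : 3 ≤ p) where
    open ≤-Reasoning
    -- Rounding d down to a power of 2 loses less than a factor 2, which the exponent s - 1 ≥ 2
    -- makes up.
    1+d≤ : suc d ≤ 2 ^ e * suc (suc k)
    1+d≤ = begin
      suc d                  ≤⟨ d<2^e+1 ⟩
      2 * 2 ^ e              ≡⟨ *-comm 2 (2 ^ e) ⟩
      2 ^ e * 2              ≤⟨ *-monoʳ-≤ (2 ^ e) (s≤s (s≤s z≤n)) ⟩
      2 ^ e * suc (suc k)    ∎
    fromSystem : ∀ {Q} → Q ≡ p ^ (2 ^ e) →
      (∃ λ R → Q ≤ R * 2 ^ e × (∀ {t} → (2 ^ e) ^ suc (suc k) < t → AgreementSystem (suc (suc (suc k))) t R (p ^ suc (suc k)) p)) →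
      ∃ λ R → AgreementSystem (suc (suc (suc k))) t R (p ^ suc (suc k)) p × p ^ suc d ≤ (2 ^ e * R) ^ suc (suc k)
    fromSystem {Q} Q≡ (R , Q≤ , system) = R , system (≤-<-trans (^-monoˡ-≤ (suc (suc k)) 2^e≤d) d^k<t) , (begin
      p ^ suc d                       ≤⟨ ^-monoʳ-≤ p {{>-nonZero (≤-trans (s≤s z≤n) 3≤p)}} 1+d≤ ⟩
      p ^ (2 ^ e * suc (suc k))       ≡⟨ ^-*-assoc p (2 ^ e) (suc (suc k)) ⟨
      (p ^ 2 ^ e) ^ suc (suc k)       ≡⟨ cong (_^ suc (suc k)) Q≡ ⟨
      Q ^ suc (suc k)                 ≤⟨ ^-monoˡ-≤ (suc (suc k)) (≤-trans Q≤ (≤-reflexive (*-comm R (2 ^ e)))) ⟩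
      (2 ^ e * R) ^ suc (suc k)       ∎)
    functions : ∃ λ R → AgreementSystem (suc (suc (suc k))) t R (p ^ suc (suc k)) p × p ^ suc d ≤ (2 ^ e * R) ^ suc (suc k)
    functions = fromSystem (GaloisField.Q≡p^D G) (NormSystem.normSystem pr G (suc (suc k)))
      where G = galoisField2^ pr 3≤p e

trivialSystem : ∀ s t → AgreementSystem (suc (suc s)) t 1 1 1
trivialSystem s t = record
  { f = λ _ _ → zero
  ; fewAgreements = λ g g-inj _ _ _ → contradiction (Fin.injective⇒≤ g-inj) λ { (s≤s ()) }
  }

-- By m ≤ bR, the min(m, R) rows that carry ones account for all m rows up to the factor `b`.
matrixBound : ∀ k t {R A B m n C b} → AgreementSystem (suc (suc k)) (suc t) R A B → A * B ≤ n →
  1 ≤ b → m ≤ b * R → n ^ suc k ≤ (C * A) ^ suc (suc k) →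
  Σ (Matrix m n) λ M → KstFree (suc (suc k)) (suc t) M × m ^ suc (suc k) * n ^ suc k ≤ (b * C * ones M) ^ suc (suc k)
matrixBound k t {R} {A} {B} {m} {n} {C} {b} system AB≤n 1≤b m≤bR n^k≤ with agreementMatrix system m n AB≤n
... | M , free , many = M , free , (begin
  m ^ s * n ^ suc k                ≤⟨ *-mono-≤ (^-monoˡ-≤ s m≤b[m⊓R]) n^k≤ ⟩
  (b * (m ⊓ R)) ^ s * (C * A) ^ s  ≡⟨ ^-distribʳ-* s (b * (m ⊓ R)) (C * A) ⟨
  (b * (m ⊓ R) * (C * A)) ^ s      ≡⟨ cong (_^ s) (solve 4 (λ b r C A → b :* r :* (C :* A) := b :* C :* (r :* A)) refl b (m ⊓ R) C A) ⟩
  (b * C * ((m ⊓ R) * A)) ^ s      ≤⟨ ^-monoˡ-≤ s (*-monoʳ-≤ (b * C) many) ⟩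
  (b * C * ones M) ^ s             ∎)
  where
  open ≤-Reasoning
  s : ℕ
  s = suc (suc k)
  m≤b[m⊓R] : m ≤ b * (m ⊓ R)
  m≤b[m⊓R] = subst (m ≤_) (sym (*-distribˡ-⊓ b m R)) (⊓-glb (m≤n*m m b {{>-nonZero 1≤b}}) m≤bR)

module Construction (k t d : ℕ) (t<[d+1]^k : suc t ≤ suc d ^ suc k) {c} (1≤c : 1 ≤ c) (primes : Chebyshev.NearPowersOf4 c)
  {e} (1≤e : 1 ≤ e) (systems : PrimeSystems k (suc t) d e) where
  open ≤-Reasoning
  s : ℕ
  s = suc (suc k)
  C E b : ℕ
  -- `C` gives n ≤ (Cq)^s: 4 pays for rounding n^(1/s) to a power of 4, and `c` for the prime below
  -- it. `E` gives m^(s-1) ≤ E q^(d+1). `b` combines the loss eE in the number of rows with the loss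
  -- C^(s-1) in the ones per row.
  C = 4 * c
  E = 2 * C ^ suc d
  b = e * E * C ^ suc k
  1≤C : 1 ≤ C
  1≤C = *-mono-≤ {1} {4} (s≤s z≤n) 1≤c
  instance
    C≢0 : NonZero C
    C≢0 = >-nonZero 1≤C
  1≤E : 1 ≤ E
  1≤E = *-mono-≤ {1} {2} (s≤s z≤n) (m^n>0 C (suc d))
  1≤eE : 1 ≤ e * E
  1≤eE = *-mono-≤ 1≤e 1≤E
  1≤b : 1 ≤ b
  1≤b = *-mono-≤ 1≤eE (m^n>0 C (suc k))

  m^k≤ : ∀ m n q → 1 ≤ n → BelowExp s (suc t) m n → n ≤ (C * q) ^ s → m ^ suc k ≤ E * q ^ suc d
  m^k≤ m n q 1≤n below n≤ = ^-cancelˡ-≤ s (begin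
    (m ^ suc k) ^ s                  ≡⟨ ^-*-assoc m (suc k) s ⟩
    m ^ (suc k * s)                  ≡⟨ cong (m ^_) (*-comm (suc k) s) ⟩
    m ^ (s * suc k)                  ≤⟨ belowExp⇒ k d (suc t) m n t<[d+1]^k 1≤n below ⟩
    -- The factor 2 is enlarged to 2^s so that the right side becomes an s-th power and the root can
    -- be extracted.
    2 * n ^ suc d                    ≤⟨ *-mono-≤ (m≤m^n 2 s) (^-monoˡ-≤ (suc d) n≤) ⟩
    2 ^ s * ((C * q) ^ s) ^ suc d    ≡⟨ cong (2 ^ s *_) (^-swap (C * q) s (suc d)) ⟩
    2 ^ s * ((C * q) ^ suc d) ^ s    ≡⟨ ^-distribʳ-* s 2 ((C * q) ^ suc d) ⟨
    (2 * (C * q) ^ suc d) ^ s        ≡⟨ cong (λ z → (2 * z) ^ s) (^-distribʳ-* (suc d) C q) ⟩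
    (2 * (C ^ suc d * q ^ suc d)) ^ s ≡⟨ cong (_^ s) (*-assoc 2 (C ^ suc d) (q ^ suc d)) ⟨
    (E * q ^ suc d) ^ s              ∎)

  n^k≤ : ∀ n q → n ≤ (C * q) ^ s → n ^ suc k ≤ (C ^ suc k * q ^ suc k) ^ s
  n^k≤ n q n≤ = begin
    n ^ suc k                        ≤⟨ ^-monoˡ-≤ (suc k) n≤ ⟩
    ((C * q) ^ s) ^ suc k            ≡⟨ ^-swap (C * q) s (suc k) ⟩
    ((C * q) ^ suc k) ^ s            ≡⟨ cong (_^ s) (^-distribʳ-* (suc k) C q) ⟩
    (C ^ suc k * q ^ suc k) ^ s      ∎

  fromSystem : ∀ m n q {R B} → AgreementSystem s (suc t) R (q ^ suc k) B → 1 ≤ n → BelowExp s (suc t) m n →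
    q ^ suc k * B ≤ n → n ≤ (C * q) ^ s → q ^ suc d ≤ (e * R) ^ suc k →
    Σ (Matrix m n) λ M → KstFree s (suc t) M × (1 ^ s * m ^ s * n ^ suc k ≤ (b * ones M) ^ s)
  fromSystem m n q {R} system 1≤n below qB≤n n≤ q^d≤ =
    M , proj₁ spec , subst (_≤ (b * ones M) ^ s)
      (cong (_* n ^ suc k) (sym (trans (cong (_* m ^ s) (^-zeroˡ s)) (*-identityˡ (m ^ s))))) (proj₂ spec)
    where
    m≤ : m ≤ e * E * R
    m≤ = ^-cancelˡ-≤ (suc k) (begin
      m ^ suc k                        ≤⟨ m^k≤ m n q 1≤n below n≤ ⟩
      E * q ^ suc d                    ≤⟨ *-mono-≤ (m≤m^n E (suc k)) q^d≤ ⟩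
      E ^ suc k * (e * R) ^ suc k      ≡⟨ ^-distribʳ-* (suc k) E (e * R) ⟨
      (E * (e * R)) ^ suc k            ≡⟨ cong (_^ suc k) (solve 3 (λ E e R → E :* (e :* R) := e :* E :* R) refl E e R) ⟩
      (e * E * R) ^ suc k              ∎)
    bounded = matrixBound k t {C = C ^ suc k} system qB≤n 1≤eE m≤ (n^k≤ n q n≤)
    M = proj₁ bounded
    spec = proj₂ bounded

  matrixFromPrimes : ∀ m n → 1 ≤ n → BelowExp s (suc t) m n → ∀ h → (4 ^ suc h) ^ s ≤ n → n < (4 ^ suc (suc h)) ^ s →
    (∃ λ p → Prime p × 3 ≤ p × p ≤ 4 ^ suc h × 4 ^ suc h ≤ c * p) →
    Σ (Matrix m n) λ M → KstFree s (suc t) M × (1 ^ s * m ^ s * n ^ suc k ≤ (b * ones M) ^ s)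
  matrixFromPrimes m n 1≤n below h 4^hs≤n n<4^hs (p , pr , 3≤p , p≤4^h , 4^h≤cp) =
    fromSystem m n p (proj₁ (proj₂ (systems pr 3≤p))) 1≤n below
      (≤-trans (≤-reflexive (*-comm (p ^ suc k) p)) (≤-trans (^-monoˡ-≤ s p≤4^h) 4^hs≤n))
      (≤-trans (<⇒≤ n<4^hs) (^-monoˡ-≤ s (≤-trans (*-monoʳ-≤ 4 4^h≤cp) (≤-reflexive (sym (*-assoc 4 c p))))))
      (proj₂ (proj₂ (systems pr 3≤p)))

  matrix : ∀ m n → 1 ≤ m → 1 ≤ n → BelowExp s (suc t) m n →
    Σ (Matrix m n) λ M → KstFree s (suc t) M × (1 ^ s * m ^ s * n ^ suc k ≤ (b * ones M) ^ s)
  matrix m n _ 1≤n below = fromScale (straddle (λ h → (4 ^ h) ^ s) (λ h → ^-monoˡ-< s (^-monoʳ-< 4 (s≤s (s≤s z≤n)) (n<1+n h))) n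
    (≤-trans (≤-reflexive (^-zeroˡ s)) 1≤n))
    where
    fromScale : (∃ λ h → (4 ^ h) ^ s ≤ n × n < (4 ^ suc h) ^ s) →
      Σ (Matrix m n) λ M → KstFree s (suc t) M × (1 ^ s * m ^ s * n ^ suc k ≤ (b * ones M) ^ s)
    fromScale (suc h , 4^hs≤n , n<4^hs) = matrixFromPrimes m n 1≤n below h 4^hs≤n n<4^hs (primes (suc h) (s≤s z≤n))
    -- For n < 4^s there is no prime to take; q = 1 with a single row suffices, as n and therefore m
    -- are bounded.
    fromScale (zero , _ , n<4^s) = fromSystem m n 1
      (subst (λ A → AgreementSystem s (suc t) 1 A 1) (sym (^-zeroˡ (suc k))) (trivialSystem k (suc t))) 1≤n below
      (≤-trans (≤-reflexive (trans (*-identityʳ _) (^-zeroˡ (suc k)))) 1≤n)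
      (≤-trans (<⇒≤ n<4^s) (^-monoˡ-≤ s (≤-trans (*-monoʳ-≤ 4 1≤c) (≤-reflexive (sym (*-identityʳ C))))))
      (≤-trans (≤-reflexive (^-zeroˡ (suc d))) (m^n>0 (e * 1) {{>-nonZero (*-mono-≤ 1≤e (≤-refl {1}))}} (suc k)))

theorem1p3 : (s t : ℕ) → 2 ≤ s → s ≤ t →
    Σ ℕ (λ a → Σ ℕ (λ b → 1 ≤ a × 1 ≤ b ×
    ((m n : ℕ) → 1 ≤ m → 1 ≤ n → BelowExp s t m n →
    Σ (Matrix m n) (λ M → KstFree s t M ×
    (a ^ s * m ^ s * n ^ (s ∸ 1) ≤ (b * ones M) ^ s)))))
theorem1p3 (suc (suc k)) (suc t) (s≤s (s≤s _)) (s≤s (s≤s {n = t-1} _)) =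
  -- Straddling t - 1 instead of t puts the strict inequality on the right side: d^(s-1) < t ≤
  -- (d+1)^(s-1).
  fromDegree (straddle (_^ suc k) (λ h → ^-monoˡ-< (suc k) (n<1+n h)) (suc t-1) z≤n)
  where
  fromDegree : (∃ λ d → d ^ suc k ≤ suc t-1 × suc t-1 < suc d ^ suc k) → _
  fromDegree (zero , _ , t<1) = contradiction (subst (suc t-1 <_) (^-zeroˡ (suc k)) t<1) λ { (s≤s ()) }
  fromDegree (suc d , d^k≤t , t<[d+1]^k) = 1 , b , s≤s z≤n , 1≤b , matrix
    where open Construction k (suc t-1) (suc d) t<[d+1]^k (proj₁ (proj₂ Chebyshev.oddPrimesNearPowersOf4)) (proj₂ (proj₂ Chebyshev.oddPrimesNearPowersOf4))
            (proj₁ (proj₂ (manyFunctions k (suc (suc t-1)) (suc d) (s≤s z≤n) (s≤s d^k≤t) t<[d+1]^k)))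
            (proj₂ (proj₂ (manyFunctions k (suc (suc t-1)) (suc d) (s≤s z≤n) (s≤s d^k≤t) t<[d+1]^k)))
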